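{- Let $X$, $Y$ be two dcpos, let $f \colon X \times Y \to \overline{\mathbb R}_+$ be Scott-continuous, where $X\times Y$ is the product dcpo (ordered componentwise), let $\mu$ be a continuous valuation on $X$ and $\nu$ be a continuous valuation on $Y$. If $\mu$ or $\nu$ is minimal, then $$\int_{x \in X} \left(\int_{y \in Y} f (x, y)\, d\nu\right)d\mu = \int_{y \in Y} \left(\int_{x \in X} f (x, y)\, d\mu\right)d\nu.$$
   Context: $\overline{\mathbb R}_+ = [0,+\infty]$, with $0\cdot(+\infty)=0$. Every dcpo is equipped with its Scott topology, and $\mathcal O X$ denotes the lattice of open subsets of $X$. A continuous valuation on $X$ is a Scott-continuous map $\nu \colon \mathcal O X \to \overline{\mathbb R}_+$ with $\nu(\emptyset)=0$ and $\nu(U\cup V)+\nu(U\cap V)=\nu(U)+\nu(V)$ for all $U,V\in\mathcal O X$. $\mathbf V X$ is the dcpo of all continuous valuations on $X$, ordered pointwise ($\nu_1\le\nu_2$ iff $\nu_1(U)\le\nu_2(U)$ for every open $U$). For a continuous map $h\colon X\to\overline{\mathbb R}_+$ (the latter with its Scott topology), $\int_{x\in X} h(x)\,d\nu = \int_0^{+\infty}\nu(h^{ -1}(]t,+\infty]))\,dt$ (ordinary Riemann integral). $\delta_x$ is the Dirac valuation at $x$ ($\delta_x(U)=1$ if $x\in U$, $0$ otherwise). A simple valuation is a finite linear combination $\sum_{i=1}^n r_i\delta_{x_i}$ with $r_i\in\mathbb R_+=[0,+\infty[$. The set $\mathbf V_m X$ of minimal valuations is the smallest subset of $\mathbf V X$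 containing all simple valuations and closed under directed suprema taken in $\mathbf V X$. -}

module Defs where

open import Data.Empty.Polymorphic using (⊥)
open import Data.Fin.Base using (Fin; zero; suc)
open import Data.List.Base using (List; []; _∷_)
open import Data.Nat.Base using (ℕ; zero; suc)
open import Data.Product.Base using (Σ; ∃; _×_; _,_; proj₁; proj₂; swap)
open import Data.Product.Relation.Binary.Pointwise.NonDependent using (×-poset)
open import Data.Rational.Base as ℚ using (ℚ; 0ℚ; 1ℚ; ½; Positive)
import Data.Rational.Properties as ℚ
open import Data.Sum.Base using (_⊎_; inj₁; inj₂)
open import Function.Base using (_∘_)
open import Level using (Level; Lift; lift; lower; _⊔_) renaming (suc to lsuc)
open import Relation.Binary.Bundles using (Poset)
open import Relation.Binary.PropositionalEquality.Core using (_≡_; sym; trans; subst)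
open import Relation.Nullary.Negation.Core using (¬_)
open import Relation.Unary using (Pred)

------------------------------------------------------------------------
-- Directed families, suprema and Scott-continuity

module _ {c ℓ₁ ℓ₂} (P : Poset c ℓ₁ ℓ₂) where
  open Poset P renaming (Carrier to ∣P∣)

  record IsDirected {i} {I : Set i} (s : I → ∣P∣) : Set (i ⊔ ℓ₂) where
    field
      inhabitant : I
      upper      : ∀ i j → ∃ λ k → s i ≤ s k × s j ≤ s k

  record IsSup {i} {I : Set i} (s : I → ∣P∣) (x : ∣P∣) : Set (i ⊔ c ⊔ ℓ₂) where
    field
      bound : ∀ i → s i ≤ x
      least : ∀ y → (∀ i → s i ≤ y) → x ≤ y

-- Directed subsets are presented as directed families.  The level i
-- bounds the size of the index types.
record IsScottContinuous {a a₁ a₂ b b₁ b₂} (i : Level)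
         (P : Poset a a₁ a₂) (Q : Poset b b₁ b₂)
         (f : Poset.Carrier P → Poset.Carrier Q) :
         Set (lsuc i ⊔ a ⊔ a₂ ⊔ b ⊔ b₂) where
  private
    module P = Poset P
    module Q = Poset Q
  field
    mono  : ∀ {x y} → x P.≤ y → f x Q.≤ f y
    sup   : {I : Set i} (s : I → P.Carrier) → IsDirected P s →
            ∀ {x} → IsSup P s x → IsSup Q (f ∘ s) (f x)

record DCPO (ℓ : Level) : Set (lsuc ℓ) where
  field
    poset    : Poset ℓ ℓ ℓ
    complete : {I : Set ℓ} (s : I → Poset.Carrier poset) →
               IsDirected poset s → ∃ λ x → IsSup poset s x
  open Poset poset public

infixr 2 _×ᵈ_
_×ᵈ_ : ∀ {ℓ} → DCPO ℓ → DCPO ℓ → DCPO ℓ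
_×ᵈ_ {ℓ} X Y = record { poset = ×-poset X.poset Y.poset ; complete = complete }
  where
  module X = DCPO X
  module Y = DCPO Y
  complete : {I : Set ℓ} (s : I → X.Carrier × Y.Carrier) →
             IsDirected (×-poset X.poset Y.poset) s →
             ∃ λ z → IsSup (×-poset X.poset Y.poset) s z
  complete s d = (proj₁ supX , proj₁ supY) , record
    { bound = λ i → IsSup.bound (proj₂ supX) i , IsSup.bound (proj₂ supY) i
    ; least = λ z b → IsSup.least (proj₂ supX) (proj₁ z) (proj₁ ∘ b)
                    , IsSup.least (proj₂ supY) (proj₂ z) (proj₂ ∘ b)
    }
    where
    open IsDirected d
    supX = X.complete (proj₁ ∘ s) record
      { inhabitant = inhabitant
      ; upper = λ i j → let (k , p , q) = upper i j in k , proj₁ p , proj₁ q }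
    supY = Y.complete (proj₂ ∘ s) record
      { inhabitant = inhabitant
      ; upper = λ i j → let (k , p , q) = upper i j in k , proj₂ p , proj₂ q }

------------------------------------------------------------------------
-- The extended nonnegative reals [0,+∞]

-- r is given by its rounded lower cut { p ∈ ℚ ∣ p < r }, which contains
-- all negative rationals; +∞ is the cut ℚ.  Classically these cuts are
-- exactly the elements of [0,+∞], ordered by inclusion.  Cuts that are
-- only lower are what makes directed suprema (unions) available
-- constructively.
record ℝ₊∞ (ℓ : Level) : Set (lsuc ℓ) where
  field
    cut      : Pred ℚ ℓ
    negative : ∀ {p} → p ℚ.< 0ℚ → cut p
    lowered  : ∀ {p q} → p ℚ.≤ q → cut q → cut p
    rounded  : ∀ {p} → cut p → ∃ λ q → p ℚ.< q × cut q
open ℝ₊∞ public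

infix 4 _<ᶜ_ _≤ᴿ_ _≈ᴿ_

_<ᶜ_ : ∀ {ℓ} → ℚ → ℝ₊∞ ℓ → Set ℓ
p <ᶜ r = cut r p

_≤ᴿ_ : ∀ {ℓ} → ℝ₊∞ ℓ → ℝ₊∞ ℓ → Set ℓ
r ≤ᴿ s = ∀ p → p <ᶜ r → p <ᶜ s

_≈ᴿ_ : ∀ {ℓ} → ℝ₊∞ ℓ → ℝ₊∞ ℓ → Set ℓ
r ≈ᴿ s = r ≤ᴿ s × s ≤ᴿ r

ℝ₊∞-poset : ∀ ℓ → Poset (lsuc ℓ) ℓ ℓ
ℝ₊∞-poset ℓ = record
  { Carrier = ℝ₊∞ ℓ
  ; _≈_ = _≈ᴿ_
  ; _≤_ = _≤ᴿ_
  ; isPartialOrder = record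
    { isPreorder = record
      { isEquivalence = record
        { refl  = (λ _ c → c) , (λ _ c → c)
        ; sym   = swap
        ; trans = λ (a , b) (c , d) → (λ p → c p ∘ a p) , (λ p → b p ∘ d p)
        }
      ; reflexive = proj₁
      ; trans     = λ a b p → b p ∘ a p
      }
    ; antisym = _,_
    }
  }

IsFinite : ∀ {ℓ} → ℝ₊∞ ℓ → Set ℓ
IsFinite r = ∃ λ q → ¬ (q <ᶜ r)

-- max(q,0) as an extended real.
fromℚ : ∀ {ℓ} → ℚ → ℝ₊∞ ℓ
fromℚ {ℓ} q = record
  { cut      = λ p → Lift ℓ (p ℚ.< 0ℚ ⊎ p ℚ.< q)
  ; negative = λ p<0 → lift (inj₁ p<0)
  ; lowered  = λ { p≤r (lift (inj₁ r<0)) → lift (inj₁ (ℚ.≤-<-trans p≤r r<0))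
                 ; p≤r (lift (inj₂ r<q)) → lift (inj₂ (ℚ.≤-<-trans p≤r r<q)) }
  ; rounded  = λ { (lift (inj₁ p<0)) → let (m , a , b) = ℚ.<-dense p<0
                                        in m , a , lift (inj₁ b)
                 ; (lift (inj₂ p<q)) → let (m , a , b) = ℚ.<-dense p<q
                                        in m , a , lift (inj₂ b) }
  }

0ᴿ 1ᴿ : ∀ {ℓ} → ℝ₊∞ ℓ
0ᴿ = fromℚ 0ℚ
1ᴿ = fromℚ 1ℚ

-- The truth value of A: 1 if A holds, 0 otherwise.
indicator : ∀ {ℓ} → Set ℓ → ℝ₊∞ ℓ
indicator {ℓ} A = record
  { cut      = λ p → Lift ℓ (p ℚ.< 0ℚ) ⊎ (A × p ℚ.< 1ℚ)
  ; negative = λ p<0 → inj₁ (lift p<0)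
  ; lowered  = λ { p≤r (inj₁ (lift r<0)) → inj₁ (lift (ℚ.≤-<-trans p≤r r<0))
                 ; p≤r (inj₂ (a , r<1)) → inj₂ (a , ℚ.≤-<-trans p≤r r<1) }
  ; rounded  = λ { (inj₁ (lift p<0)) → let (m , u , v) = ℚ.<-dense p<0
                                        in m , u , inj₁ (lift v)
                 ; (inj₂ (a , p<1)) → let (m , u , v) = ℚ.<-dense p<1
                                       in m , u , inj₂ (a , v) }
  }

half : ∀ p → p ≡ ½ ℚ.* p ℚ.+ ½ ℚ.* p
half p = trans (sym (ℚ.*-identityˡ p)) (ℚ.*-distribʳ-+ p ½ ½)

half-negative : ∀ {p} → p ℚ.< 0ℚ → ½ ℚ.* p ℚ.< 0ℚ
half-negative {p} p<0 =
  subst (½ ℚ.* p ℚ.<_) (ℚ.*-zeroʳ ½) (ℚ.*-monoʳ-<-pos ½ p<0)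

infixl 6 _+ᴿ_
infixl 7 _*ᴿ_

_+ᴿ_ : ∀ {ℓ} → ℝ₊∞ ℓ → ℝ₊∞ ℓ → ℝ₊∞ ℓ
r +ᴿ s = record
  { cut      = λ p → ∃ λ a → ∃ λ b → a <ᶜ r × b <ᶜ s × p ℚ.≤ a ℚ.+ b
  ; negative = λ {p} p<0 → ½ ℚ.* p , ½ ℚ.* p
                 , negative r (half-negative p<0) , negative s (half-negative p<0)
                 , ℚ.≤-reflexive (half p)
  ; lowered  = λ p≤q (a , b , a<r , b<s , q≤a+b) →
                 a , b , a<r , b<s , ℚ.≤-trans p≤q q≤a+b
  ; rounded  = λ (a , b , a<r , b<s , p≤a+b) →
                 let (a′ , a<a′ , a′<r) = rounded r a<r in
                 a′ ℚ.+ b , ℚ.≤-<-trans p≤a+b (ℚ.+-monoˡ-< b a<a′)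
                 , a′ , b , a′<r , b<s , ℚ.≤-refl
  }

-- Only nonnegative rationals below the factors count, whence 0 · (+∞) = 0.
_*ᴿ_ : ∀ {ℓ} → ℝ₊∞ ℓ → ℝ₊∞ ℓ → ℝ₊∞ ℓ
_*ᴿ_ {ℓ} r s = record
  { cut      = λ p → Lift ℓ (p ℚ.< 0ℚ) ⊎ ∃ λ a → ∃ λ b →
                 0ℚ ℚ.≤ a × 0ℚ ℚ.≤ b × a <ᶜ r × b <ᶜ s × p ℚ.< a ℚ.* b
  ; negative = λ p<0 → inj₁ (lift p<0)
  ; lowered  = λ { p≤q (inj₁ (lift q<0)) → inj₁ (lift (ℚ.≤-<-trans p≤q q<0))
                 ; p≤q (inj₂ (a , b , 0≤a , 0≤b , a<r , b<s , q<ab)) →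
                     inj₂ (a , b , 0≤a , 0≤b , a<r , b<s , ℚ.≤-<-trans p≤q q<ab) }
  ; rounded  = λ { (inj₁ (lift p<0)) → let (m , u , v) = ℚ.<-dense p<0
                                        in m , u , inj₁ (lift v)
                 ; (inj₂ (a , b , 0≤a , 0≤b , a<r , b<s , p<ab)) →
                     let (m , u , v) = ℚ.<-dense p<ab
                     in m , u , inj₂ (a , b , 0≤a , 0≤b , a<r , b<s , v) }
  }

sumᴿ : ∀ {ℓ} (n : ℕ) → (Fin n → ℝ₊∞ ℓ) → ℝ₊∞ ℓ
sumᴿ zero    r = 0ᴿ
sumᴿ (suc n) r = r zero +ᴿ sumᴿ n (r ∘ suc)

-- Supremum of an inhabited family.
⋃ᴿ : ∀ {ℓ} {I : Set ℓ} → I → (I → ℝ₊∞ ℓ) → ℝ₊∞ ℓ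
⋃ᴿ i₀ s = record
  { cut      = λ p → ∃ λ i → p <ᶜ s i
  ; negative = λ p<0 → i₀ , negative (s i₀) p<0
  ; lowered  = λ p≤q (i , q<s) → i , lowered (s i) p≤q q<s
  ; rounded  = λ (i , p<s) → let (q , p<q , q<s) = rounded (s i) p<s
                             in q , p<q , i , q<s
  }

-- An element strictly below a directed supremum is below a member.
<ᶜ-sup : ∀ {ℓ} {I : Set ℓ} {s : I → ℝ₊∞ ℓ} {r} → IsDirected (ℝ₊∞-poset ℓ) s →
         IsSup (ℝ₊∞-poset ℓ) s r → ∀ {p} → p <ᶜ r → ∃ λ i → p <ᶜ s i
<ᶜ-sup {s = s} d l {p} =
  IsSup.least l (⋃ᴿ (IsDirected.inhabitant d) s) (λ i _ p<s → i , p<s) p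

------------------------------------------------------------------------
-- Scott-open subsets

record Open {ℓ} (X : DCPO ℓ) : Set (lsuc ℓ) where
  open DCPO X
  field
    mem          : Pred Carrier ℓ
    upward       : ∀ {x y} → x ≤ y → mem x → mem y
    inaccessible : {I : Set ℓ} (s : I → Carrier) → IsDirected poset s →
                   ∀ {x} → IsSup poset s x → mem x → ∃ λ i → mem (s i)
open Open public

Open-poset : ∀ {ℓ} → DCPO ℓ → Poset (lsuc ℓ) ℓ ℓ
Open-poset X = record
  { Carrier = Open X
  ; _≈_ = λ U V → (∀ x → mem U x → mem V x) × (∀ x → mem V x → mem U x)
  ; _≤_ = λ U V → ∀ x → mem U x → mem V x
  ; isPartialOrder = record
    { isPreorder = record
      { isEquivalence = record
        { refl  = (λ _ u → u) , (λ _ u → u)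
        ; sym   = swap
        ; trans = λ (a , b) (c , d) → (λ x → c x ∘ a x) , (λ x → b x ∘ d x)
        }
      ; reflexive = proj₁
      ; trans     = λ a b x → b x ∘ a x
      }
    ; antisym = _,_
    }
  }

∅ᵒ : ∀ {ℓ} {X : DCPO ℓ} → Open X
∅ᵒ = record
  { mem = λ _ → ⊥
  ; upward = λ _ ()
  ; inaccessible = λ _ _ _ ()
  }

infixr 6 _∪ᵒ_
infixr 7 _∩ᵒ_

_∪ᵒ_ : ∀ {ℓ} {X : DCPO ℓ} → Open X → Open X → Open X
U ∪ᵒ V = record
  { mem = λ x → mem U x ⊎ mem V x
  ; upward = λ { x≤y (inj₁ u) → inj₁ (upward U x≤y u)
               ; x≤y (inj₂ v) → inj₂ (upward V x≤y v) }
  ; inaccessible = λ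
      { s d l (inj₁ u) → let (i , w) = inaccessible U s d l u in i , inj₁ w
      ; s d l (inj₂ v) → let (i , w) = inaccessible V s d l v in i , inj₂ w }
  }

_∩ᵒ_ : ∀ {ℓ} {X : DCPO ℓ} → Open X → Open X → Open X
U ∩ᵒ V = record
  { mem = λ x → mem U x × mem V x
  ; upward = λ x≤y (u , v) → upward U x≤y u , upward V x≤y v
  ; inaccessible = λ s d l (u , v) →
      let (i , u′) = inaccessible U s d l u
          (j , v′) = inaccessible V s d l v
          (k , i≤k , j≤k) = IsDirected.upper d i j
      in k , upward U i≤k u′ , upward V j≤k v′
  }

------------------------------------------------------------------------
-- Continuous valuations

record Valuation {ℓ} (X : DCPO ℓ) : Set (lsuc ℓ) where
  field
    val        : Open X → ℝ₊∞ ℓ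
    continuous : IsScottContinuous ℓ (Open-poset X) (ℝ₊∞-poset ℓ) val
    strict     : val ∅ᵒ ≈ᴿ 0ᴿ
    modular    : ∀ U V → val (U ∪ᵒ V) +ᴿ val (U ∩ᵒ V) ≈ᴿ val U +ᴿ val V
open Valuation public

Valuation-poset : ∀ {ℓ} → DCPO ℓ → Poset (lsuc ℓ) (lsuc ℓ) (lsuc ℓ)
Valuation-poset X = record
  { Carrier = Valuation X
  ; _≈_ = λ μ ν → ∀ U → val μ U ≈ᴿ val ν U
  ; _≤_ = λ μ ν → ∀ U → val μ U ≤ᴿ val ν U
  ; isPartialOrder = record
    { isPreorder = record
      { isEquivalence = record
        { refl  = λ U → (λ _ c → c) , (λ _ c → c)
        ; sym   = λ a U → swap (a U)
        ; trans = λ a b U → (λ p → proj₁ (b U) p ∘ proj₁ (a U) p)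
                          , (λ p → proj₂ (a U) p ∘ proj₂ (b U) p)
        }
      ; reflexive = λ a U → proj₁ (a U)
      ; trans     = λ a b U p → b U p ∘ a U p
      }
    ; antisym = λ a b U → a U , b U
    }
  }

δ : ∀ {ℓ} {X : DCPO ℓ} → DCPO.Carrier X → Open X → ℝ₊∞ ℓ
δ x U = indicator (mem U x)

IsSimple : ∀ {ℓ} (X : DCPO ℓ) → Valuation X → Set (lsuc ℓ)
IsSimple {ℓ} X ν =
  ∃ λ (n : ℕ) → ∃ λ (r : Fin n → ℝ₊∞ ℓ) → ∃ λ (x : Fin n → DCPO.Carrier X) →
  (∀ i → IsFinite (r i)) ×
  (∀ U → val ν U ≈ᴿ sumᴿ n (λ i → r i *ᴿ δ (x i) U))

-- Up to equality of valuations, the valuations on X (a type one level up)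
-- classically form a set of the size of X's universe, so families indexed
-- at level ℓ present all directed subsets.
data IsMinimal {ℓ} (X : DCPO ℓ) : Valuation X → Set (lsuc ℓ) where
  simple : ∀ {ν} → IsSimple X ν → IsMinimal X ν
  dsup   : ∀ {ν} {I : Set ℓ} (s : I → Valuation X) →
           IsDirected (Valuation-poset X) s → IsSup (Valuation-poset X) s ν →
           (∀ i → IsMinimal X (s i)) → IsMinimal X ν

------------------------------------------------------------------------
-- Integration

infix 4 _→ℝ₊∞
record _→ℝ₊∞ {ℓ} (X : DCPO ℓ) : Set (lsuc ℓ) where
  field
    fun   : DCPO.Carrier X → ℝ₊∞ ℓ
    scott : IsScottContinuous ℓ (DCPO.poset X) (ℝ₊∞-poset ℓ) fun
open _→ℝ₊∞ public

image-directed : ∀ {ℓ} {X : DCPO ℓ} (h : X →ℝ₊∞) {I : Set ℓ}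
  {s : I → DCPO.Carrier X} → IsDirected (DCPO.poset X) s →
  IsDirected (ℝ₊∞-poset ℓ) (fun h ∘ s)
image-directed h d = record
  { inhabitant = IsDirected.inhabitant d
  ; upper = λ i j → let (k , a , b) = IsDirected.upper d i j in
      k , IsScottContinuous.mono (scott h) a , IsScottContinuous.mono (scott h) b
  }

-- superlevel h t is h⁻¹(]t,+∞]).
superlevel : ∀ {ℓ} {X : DCPO ℓ} → X →ℝ₊∞ → ℚ → Open X
superlevel h t = record
  { mem = λ x → t <ᶜ fun h x
  ; upward = λ x≤y → IsScottContinuous.mono (scott h) x≤y t
  ; inaccessible = λ s d l →
      <ᶜ-sup (image-directed h d) (IsScottContinuous.sup (scott h) s d l)
  }

-- A partition a = t₀ < t₁ < … < tₙ of an interval is given by its steps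
-- tₖ − tₖ₋₁.
Steps : Set
Steps = List (Σ ℚ Positive)

-- The lower Darboux sum Σₖ (tₖ − tₖ₋₁) · g(tₖ) of an antitone map g: the
-- infimum of g over [tₖ₋₁,tₖ] is g(tₖ).
lowerSum : ∀ {ℓ} → (ℚ → ℝ₊∞ ℓ) → ℚ → Steps → ℝ₊∞ ℓ
lowerSum g a []             = 0ᴿ
lowerSum g a ((d , _) ∷ ds) =
  fromℚ d *ᴿ g (a ℚ.+ d) +ᴿ lowerSum g (a ℚ.+ d) ds

-- The (improper) Riemann integral over [0,+∞[ of an antitone map g, namely
-- the supremum of its lower Darboux sums over all partitions of all
-- intervals [0,T].  As g is antitone, rational partition points suffice, and
-- on every [a,T] with g(a) finite the lower and upper sums have the same
-- limit.
riemann : ∀ {ℓ} → (ℚ → ℝ₊∞ ℓ) → ℝ₊∞ ℓ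
riemann {ℓ} g = ⋃ᴿ {I = Lift ℓ Steps} (lift []) (λ ds → lowerSum g 0ℚ (lower ds))

∫ : ∀ {ℓ} {X : DCPO ℓ} → X →ℝ₊∞ → Valuation X → ℝ₊∞ ℓ
∫ h ν = riemann (λ t → val ν (superlevel h t))

------------------------------------------------------------------------
-- Integration of one variable of a function of two

-- f(x,·)
section : ∀ {ℓ} (X Y : DCPO ℓ) → (X ×ᵈ Y) →ℝ₊∞ → DCPO.Carrier X → Y →ℝ₊∞
section X Y f x = record
  { fun   = λ y → fun f (x , y)
  ; scott = record
    { mono = λ y≤y′ → mono (X.refl , y≤y′)
    ; sup  = λ s d l → sup (λ i → x , s i)
        record { inhabitant = IsDirected.inhabitant d
               ; upper = λ i j → let (k , a , b) = IsDirected.upper d i j in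
                   k , (X.refl , a) , (X.refl , b) }
        record { bound = λ i → X.refl , IsSup.bound l i
               ; least = λ z b → proj₁ (b (IsDirected.inhabitant d))
                               , IsSup.least l (proj₂ z) (proj₂ ∘ b) }
    }
  }
  where
  module X = DCPO X
  open IsScottContinuous (scott f)

transpose : ∀ {ℓ} (X Y : DCPO ℓ) → (X ×ᵈ Y) →ℝ₊∞ → (Y ×ᵈ X) →ℝ₊∞
transpose X Y f = record
  { fun   = λ (y , x) → fun f (x , y)
  ; scott = record
    { mono = λ (p , q) → mono (q , p)
    ; sup  = λ s d l → sup (swap ∘ s)
        record { inhabitant = IsDirected.inhabitant d
               ; upper = λ i j → let (k , a , b) = IsDirected.upper d i j in
                   k , swap a , swap b }
        record { bound = swap ∘ IsSup.bound l
               ; least = λ z b → swap (IsSup.least l (swap z) (swap ∘ b)) }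
    }
  }
  where open IsScottContinuous (scott f)

+ᴿ-mono : ∀ {ℓ} {r r′ s s′ : ℝ₊∞ ℓ} → r ≤ᴿ r′ → s ≤ᴿ s′ → r +ᴿ s ≤ᴿ r′ +ᴿ s′
+ᴿ-mono r≤r′ s≤s′ p (a , b , a<r , b<s , p≤) = a , b , r≤r′ a a<r , s≤s′ b b<s , p≤

*ᴿ-monoʳ : ∀ {ℓ} (r : ℝ₊∞ ℓ) {s s′ : ℝ₊∞ ℓ} → s ≤ᴿ s′ → r *ᴿ s ≤ᴿ r *ᴿ s′
*ᴿ-monoʳ r s≤s′ p (inj₁ p<0) = inj₁ p<0
*ᴿ-monoʳ r s≤s′ p (inj₂ (a , b , 0≤a , 0≤b , a<r , b<s , p<)) =
  inj₂ (a , b , 0≤a , 0≤b , a<r , s≤s′ b b<s , p<)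

lowerSum-mono : ∀ {ℓ} {g g′ : ℚ → ℝ₊∞ ℓ} → (∀ t → g t ≤ᴿ g′ t) →
                ∀ a ds → lowerSum g a ds ≤ᴿ lowerSum g′ a ds
lowerSum-mono g≤g′ a []       p c = c
lowerSum-mono {g = g} {g′} g≤g′ a ((d , _) ∷ ds) =
  +ᴿ-mono {r = fromℚ d *ᴿ g (a ℚ.+ d)} {fromℚ d *ᴿ g′ (a ℚ.+ d)}
          {lowerSum g (a ℚ.+ d) ds} {lowerSum g′ (a ℚ.+ d) ds}
    (*ᴿ-monoʳ (fromℚ d) {g (a ℚ.+ d)} {g′ (a ℚ.+ d)} (g≤g′ (a ℚ.+ d)))
    (lowerSum-mono g≤g′ (a ℚ.+ d) ds)

lowerSum-sup : ∀ {ℓ} {I : Set ℓ} (g : ℚ → ℝ₊∞ ℓ) (G : I → ℚ → ℝ₊∞ ℓ) → I →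
  (∀ i j → ∃ λ k → (∀ t → G i t ≤ᴿ G k t) × (∀ t → G j t ≤ᴿ G k t)) →
  (∀ t {p} → p <ᶜ g t → ∃ λ i → p <ᶜ G i t) →
  ∀ a ds {p} → p <ᶜ lowerSum g a ds → ∃ λ i → p <ᶜ lowerSum (G i) a ds
lowerSum-sup g G i₀ dir app a []             c = i₀ , c
lowerSum-sup g G i₀ dir app a ((d , _) ∷ ds) (u , v , u< , v< , p≤)
  with lowerSum-sup g G i₀ dir app (a ℚ.+ d) ds v< | u<
... | j , v<′ | inj₁ u<0 = j , u , v , inj₁ u<0 , v<′ , p≤
... | j , v<′ | inj₂ (m , b , 0≤m , 0≤b , m<d , b<g , u<mb) =
  let (i , b<G)       = app (a ℚ.+ d) b<g
      (k , i≤k , j≤k) = dir i j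
  in k , u , v , inj₂ (m , b , 0≤m , 0≤b , m<d , i≤k (a ℚ.+ d) b b<G , u<mb)
     , lowerSum-mono j≤k (a ℚ.+ d) ds v v<′ , p≤

-- x ↦ ∫_{y ∈ Y} f(x,y) dν, which is again Scott-continuous.
∫ʸ : ∀ {ℓ} (X Y : DCPO ℓ) → (X ×ᵈ Y) →ℝ₊∞ → Valuation Y → X →ℝ₊∞
∫ʸ {ℓ} X Y f ν = record
  { fun   = λ x → ∫ (section X Y f x) ν
  ; scott = record
    { mono = ∫-mono
    ; sup  = λ s d {x} l → record
      { bound = λ i → ∫-mono (IsSup.bound l i)
      ; least = λ r b p (ds , c) →
          let (i , c′) = lowerSum-sup (level x) (level ∘ s)
                           (IsDirected.inhabitant d)
                           (λ i j → let (k , i≤k , j≤k) = IsDirected.upper d i j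
                                    in k , level-mono i≤k , level-mono j≤k)
                           (level-sup s d l) 0ℚ (lower ds) c
          in b i p (ds , c′)
      }
    }
  }
  where
  module X = DCPO X
  module Y = DCPO Y
  module f = IsScottContinuous (scott f)
  module ν = IsScottContinuous (continuous ν)

  level : X.Carrier → ℚ → ℝ₊∞ ℓ
  level x t = val ν (superlevel (section X Y f x) t)

  superlevel-mono : ∀ {x x′} → x X.≤ x′ → ∀ t →
    Poset._≤_ (Open-poset Y) (superlevel (section X Y f x) t)
                             (superlevel (section X Y f x′) t)
  superlevel-mono x≤x′ t y = f.mono (x≤x′ , Y.refl) t

  level-mono : ∀ {x x′} → x X.≤ x′ → ∀ t → level x t ≤ᴿ level x′ t
  level-mono x≤x′ t = ν.mono (superlevel-mono x≤x′ t)

  ∫-mono : ∀ {x x′} → x X.≤ x′ → ∫ (section X Y f x) ν ≤ᴿ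
                                   ∫ (section X Y f x′) ν
  ∫-mono x≤x′ p (ds , c) = ds , lowerSum-mono (level-mono x≤x′) 0ℚ (lower ds) p c

  level-sup : {I : Set ℓ} (s : I → X.Carrier) → IsDirected X.poset s →
    ∀ {x} → IsSup X.poset s x → ∀ t {p} → p <ᶜ level x t → ∃ λ i → p <ᶜ level (s i) t
  level-sup s d {x} l t = <ᶜ-sup
    record { inhabitant = inhabitant
           ; upper = λ i j → let (k , i≤k , j≤k) = upper i j
                             in k , level-mono i≤k t , level-mono j≤k t }
    (ν.sup (λ i → superlevel (section X Y f (s i)) t)
      record { inhabitant = inhabitant
             ; upper = λ i j → let (k , i≤k , j≤k) = upper i j
                               in k , superlevel-mono i≤k t , superlevel-mono j≤k t }
      record
        { bound = λ i → superlevel-mono (IsSup.bound l i) t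
        ; least = λ V b y t<f →
            let sup-at-y = f.sup (λ i → s i , y)
                  record { inhabitant = inhabitant
                         ; upper = λ i j → let (k , i≤k , j≤k) = upper i j
                                           in k , (i≤k , Y.refl) , (j≤k , Y.refl) }
                  record { bound = λ i → IsSup.bound l i , Y.refl
                         ; least = λ z b′ → IsSup.least l (proj₁ z) (proj₁ ∘ b′)
                                          , proj₂ (b′ inhabitant) }
                (i , t<fᵢ) = <ᶜ-sup
                  record { inhabitant = inhabitant
                         ; upper = λ i j → let (k , i≤k , j≤k) = upper i j
                                           in k , f.mono (i≤k , Y.refl)
                                                , f.mono (j≤k , Y.refl) }
                  sup-at-y t<f
            in b i y t<fᵢ
        })
    where open IsDirected d

-- y ↦ ∫_{x ∈ X} f(x,y) dμ.
∫ˣ : ∀ {ℓ} (X Y : DCPO ℓ) → (X ×ᵈ Y) →ℝ₊∞ → Valuation X → Y →ℝ₊∞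
∫ˣ X Y f μ = ∫ʸ Y X (transpose X Y f) μ

{-# OPTIONS --safe #-}

-- For a simple valuation Σᵢ rᵢ δ_{xᵢ} the equation is the linearity of the
-- integral, and both sides are Scott-continuous in the minimal valuation, so
-- it passes to directed suprema.
--
-- Additivity ∫ (h + h′) dν = ∫ h dν + ∫ h′ dν is the substantial point.  On a
-- partition of mesh e, the two lower sums on the right add up to e times the
-- sum of ν over the list of all superlevel sets of h and h′ at multiples of e.
-- By modularity that sum does not change if the list is replaced by the
-- decreasing sequence of the opens Wₖ of points lying in at least k members of
-- the list, and Wₖ is contained in { h + h′ > k e } and, up to the length of the
-- partition, contains { h + h′ > (k + 1) e }.

module Submission where

open import Defs
open import Algebra.Bundles using (CommutativeMonoid; CommutativeRing)
import Algebra.Properties.CommutativeSemigroup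
import Algebra.Properties.Semiring.Mult
open import Data.Fin.Base using (Fin; zero; suc)
open import Data.Integer.Base using (+_; +[1+_])
import Data.Integer.Properties as ℤ
import Data.Integer.Solver as ℤ
open import Data.List.Base using (List; []; _∷_; _++_; length; replicate)
open import Data.List.Relation.Unary.All as All using (All; []; _∷_)
import Data.List.Relation.Unary.All.Properties as All
open import Data.Nat.Base as ℕ using (ℕ; zero; suc)
import Data.Nat.Properties as ℕ
open import Data.Product.Base using (∃; _×_; _,_; proj₁; proj₂)
open import Data.Rational.Base as ℚ using (ℚ; mkℚ; 0ℚ; 1ℚ)
import Data.Rational.Properties as ℚ
open import Data.Rational.Solver using (module +-*-Solver)
open import Data.Rational.Unnormalised.Base as ℚᵘ using (mkℚᵘ; *≡*)
import Data.Rational.Unnormalised.Properties as ℚᵘ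
open import Data.Sum.Base using (_⊎_; inj₁; inj₂)
open import Data.Unit.Polymorphic.Base using (⊤; tt)
open import Function.Base using (_∘_)
open import Level using (Level; Lift; lift; lower) renaming (suc to lsuc)
open import Relation.Binary.Bundles using (Poset)
open import Relation.Binary.PropositionalEquality.Core using (_≡_; refl; sym; trans; subst; subst₂; cong; cong₂)
import Relation.Binary.Reasoning.PartialOrder
open import Relation.Nullary.Decidable.Core using (yes; no)
open import Relation.Nullary.Negation.Core using (¬_; contradiction)

open Algebra.Properties.Semiring.Mult (CommutativeRing.semiring ℚ.+-*-commutativeRing)
  using (×-homo-+; ×-assocˡ; ×-assoc-*; ×-comm-*) renaming (_×_ to _·_)

-- Values are lower cuts, possibly +∞, so error terms cannot be subtracted, and neither finiteness
-- nor membership in an open can be decided. Inequalities are therefore proved by carrying a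
-- rational below the left side over to the right side, and suprema are handled by finding one index
-- that already exceeds the given rational. The obstacle is the mesh width lost between Wₖ and { h +
-- h′ > (k + 1) e }: where ν is infinite, no error estimate makes it small. Instead { h + h′ > t }
-- is exhausted by the sets { h + h′ > t + c }; Scott-continuity of ν yields a c that keeps the
-- given rational below the lower sum, and this same c becomes the mesh. It can only do so if all
-- steps are multiples of c, which is why steps are measured by common rational units.

private variable
  ℓ : Level
  X : DCPO ℓ

-- Rational arithmetic

*-mono-nonNeg : ∀ {a b c d} → 0ℚ ℚ.≤ a → a ℚ.≤ c → 0ℚ ℚ.≤ b → b ℚ.≤ d → a ℚ.* b ℚ.≤ c ℚ.* d
*-mono-nonNeg {a} {b} {c} {d} 0≤a a≤c 0≤b b≤d = ℚ.≤-trans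
  (ℚ.*-monoˡ-≤-nonNeg a {{ℚ.nonNegative 0≤a}} b≤d)
  (ℚ.*-monoʳ-≤-nonNeg d {{ℚ.nonNegative (ℚ.≤-trans 0≤b b≤d)}} a≤c)

*-mono-<-nonNeg : ∀ {a b c d} → 0ℚ ℚ.≤ a → a ℚ.< c → 0ℚ ℚ.≤ b → b ℚ.< d → a ℚ.* b ℚ.< c ℚ.* d
*-mono-<-nonNeg {a} {b} {c} {d} 0≤a a<c 0≤b b<d = ℚ.≤-<-trans
  (ℚ.*-monoˡ-≤-nonNeg a {{ℚ.nonNegative 0≤a}} (ℚ.<⇒≤ b<d))
  (ℚ.*-monoˡ-<-pos d {{ℚ.positive (ℚ.≤-<-trans 0≤b b<d)}} a<c)

*-nonNeg : ∀ {a b} → 0ℚ ℚ.≤ a → 0ℚ ℚ.≤ b → 0ℚ ℚ.≤ a ℚ.* b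
*-nonNeg {a} {b} 0≤a 0≤b = *-mono-nonNeg {0ℚ} {0ℚ} {a} {b} ℚ.≤-refl 0≤a ℚ.≤-refl 0≤b

*-pos : ∀ {a b} → 0ℚ ℚ.< a → 0ℚ ℚ.< b → 0ℚ ℚ.< a ℚ.* b
*-pos {a} {b} 0<a 0<b = *-mono-<-nonNeg {0ℚ} {0ℚ} {a} {b} ℚ.≤-refl 0<a ℚ.≤-refl 0<b

+-cancelˡ-< : ∀ c {a b} → c ℚ.+ a ℚ.< c ℚ.+ b → a ℚ.< b
+-cancelˡ-< c {a} {b} c+a<c+b = ℚ.≰⇒> λ b≤a → ℚ.<-irrefl refl (ℚ.<-≤-trans c+a<c+b (ℚ.+-monoʳ-≤ c b≤a))

+-neg-< : ∀ {p a b} → a ℚ.< 0ℚ → p ℚ.≤ a ℚ.+ b → p ℚ.< b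
+-neg-< {p} {a} {b} a<0 p≤ =
  ℚ.≤-<-trans p≤ (subst (a ℚ.+ b ℚ.<_) (ℚ.+-identityˡ b) (ℚ.+-monoˡ-< b a<0))

<⇒≱ : ∀ {a b} → a ℚ.< b → ¬ b ℚ.≤ a
<⇒≱ a<b b≤a = ℚ.<-irrefl refl (ℚ.<-≤-trans a<b b≤a)

reciprocal : ∀ {a} → 0ℚ ℚ.< a → ∃ λ c → 0ℚ ℚ.< c × c ℚ.* a ≡ 1ℚ
reciprocal {a} 0<a = ℚ.1/ a , ℚ.positive⁻¹ _ {{ℚ.1/pos⇒pos a}} , ℚ.*-inverseˡ a
  where instance
    _ = ℚ.positive 0<a
    _ = ℚ.pos⇒nonZero a

cancel-reciprocal : ∀ {a c} x → c ℚ.* a ≡ 1ℚ → c ℚ.* (a ℚ.* x) ≡ x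
cancel-reciprocal {a} {c} x ca≡1 =
  trans (sym (ℚ.*-assoc c a x)) (trans (cong (ℚ._* x) ca≡1) (ℚ.*-identityˡ x))

<-split : ∀ {p a b} → p ℚ.< a ℚ.+ b →
          ∃ λ u → ∃ λ v → u ℚ.< a × v ℚ.< b × p ℚ.≤ u ℚ.+ v
<-split {p} {a} {b} p<a+b with ℚ.<-dense p<a+b
... | m , p<m , m<a+b = m ℚ.- b , p ℚ.- m ℚ.+ b
  , subst (m ℚ.- b ℚ.<_) (solve 2 (λ a b → a :+ b :- b := a) refl a b) (ℚ.+-monoˡ-< (ℚ.- b) m<a+b)
  , subst (p ℚ.- m ℚ.+ b ℚ.<_) (solve 2 (λ m b → m :- m :+ b := b) refl m b)
      (ℚ.+-monoˡ-< b (ℚ.+-monoˡ-< (ℚ.- m) p<m))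
  , ℚ.≤-reflexive (solve 3 (λ p m b → p := m :- b :+ (p :- m :+ b)) refl p m b)
  where open +-*-Solver

-- Lower reals

infix 4 _≼_ _≋_

-- Unlike the function space _≤ᴿ_, a record lets Agda infer its two sides.
record _≼_ (r s : ℝ₊∞ ℓ) : Set ℓ where
  constructor ⟨_⟩
  field at : ∀ {p} → p <ᶜ r → p <ᶜ s
open _≼_

record _≋_ (r s : ℝ₊∞ ℓ) : Set ℓ where
  constructor _,_
  field
    ≋⇒≼ : r ≼ s
    ≋⇒≽ : s ≼ r
open _≋_

≼-refl : {r : ℝ₊∞ ℓ} → r ≼ r
≼-refl = ⟨ (λ c → c) ⟩

≼-trans : {r s t : ℝ₊∞ ℓ} → r ≼ s → s ≼ t → r ≼ t
≼-trans ⟨ f ⟩ ⟨ g ⟩ = ⟨ (λ c → g (f c)) ⟩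

≋-refl : {r : ℝ₊∞ ℓ} → r ≋ r
≋-refl = ≼-refl , ≼-refl

≋-sym : {r s : ℝ₊∞ ℓ} → r ≋ s → s ≋ r
≋-sym (a , b) = b , a

≋-trans : {r s t : ℝ₊∞ ℓ} → r ≋ s → s ≋ t → r ≋ t
≋-trans (a , b) (c , d) = ≼-trans a c , ≼-trans d b

≈⇒≋ : {r s : ℝ₊∞ ℓ} → r ≈ᴿ s → r ≋ s
≈⇒≋ (f , g) = ⟨ f _ ⟩ , ⟨ g _ ⟩

≋⇒≈ : {r s : ℝ₊∞ ℓ} → r ≋ s → r ≈ᴿ s
≋⇒≈ (⟨ f ⟩ , ⟨ g ⟩) = (λ _ → f) , (λ _ → g)

≼-poset : ∀ ℓ → Poset (lsuc ℓ) ℓ ℓ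
≼-poset ℓ = record
  { Carrier = ℝ₊∞ ℓ
  ; _≈_ = _≋_
  ; _≤_ = _≼_
  ; isPartialOrder = record
    { isPreorder = record
      { isEquivalence = record { refl = ≋-refl ; sym = ≋-sym ; trans = ≋-trans }
      ; reflexive = ≋⇒≼
      ; trans = ≼-trans
      }
    ; antisym = _,_
    }
  }

module ≼-Reasoning {ℓ} = Relation.Binary.Reasoning.PartialOrder (≼-poset ℓ)

+-mono : {r r′ s s′ : ℝ₊∞ ℓ} → r ≼ r′ → s ≼ s′ → r +ᴿ s ≼ r′ +ᴿ s′
+-mono ⟨ f ⟩ ⟨ g ⟩ = ⟨ (λ (a , b , a<r , b<s , p≤) → a , b , f a<r , g b<s , p≤) ⟩

+-cong : {r r′ s s′ : ℝ₊∞ ℓ} → r ≋ r′ → s ≋ s′ → r +ᴿ s ≋ r′ +ᴿ s′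
+-cong (a , b) (c , d) = +-mono a c , +-mono b d

+-comm-≼ : (r s : ℝ₊∞ ℓ) → r +ᴿ s ≼ s +ᴿ r
+-comm-≼ r s = ⟨ (λ (a , b , a<r , b<s , p≤) →
  b , a , b<s , a<r , ℚ.≤-trans p≤ (ℚ.≤-reflexive (ℚ.+-comm a b))) ⟩

+-comm : (r s : ℝ₊∞ ℓ) → r +ᴿ s ≋ s +ᴿ r
+-comm r s = +-comm-≼ r s , +-comm-≼ s r

+-assoc-≼ : (r s t : ℝ₊∞ ℓ) → r +ᴿ s +ᴿ t ≼ r +ᴿ (s +ᴿ t)
+-assoc-≼ r s t = ⟨ (λ (u , c , (a , b , a<r , b<s , u≤) , c<t , p≤) →
  a , b ℚ.+ c , a<r , (b , c , b<s , c<t , ℚ.≤-refl)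
    , ℚ.≤-trans p≤ (ℚ.≤-trans (ℚ.+-monoˡ-≤ c u≤) (ℚ.≤-reflexive (ℚ.+-assoc a b c)))) ⟩

+-assoc : (r s t : ℝ₊∞ ℓ) → r +ᴿ s +ᴿ t ≋ r +ᴿ (s +ᴿ t)
+-assoc r s t = +-assoc-≼ r s t , (begin
  r +ᴿ (s +ᴿ t)  ≈⟨ +-comm r (s +ᴿ t) ⟩
  s +ᴿ t +ᴿ r    ≤⟨ +-assoc-≼ s t r ⟩
  s +ᴿ (t +ᴿ r)  ≈⟨ +-comm s (t +ᴿ r) ⟩
  t +ᴿ r +ᴿ s    ≤⟨ +-assoc-≼ t r s ⟩
  t +ᴿ (r +ᴿ s)  ≈⟨ +-comm t (r +ᴿ s) ⟩
  r +ᴿ s +ᴿ t    ∎)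
  where open ≼-Reasoning

0≼ : (r : ℝ₊∞ ℓ) → 0ᴿ ≼ r
0≼ r = ⟨ (λ { (lift (inj₁ p<0)) → negative r p<0 ; (lift (inj₂ p<0)) → negative r p<0 }) ⟩

<0⇒neg : ∀ {p} → p <ᶜ 0ᴿ {ℓ} → p ℚ.< 0ℚ
<0⇒neg (lift (inj₁ p<0)) = p<0
<0⇒neg (lift (inj₂ p<0)) = p<0

+-identityˡ : (r : ℝ₊∞ ℓ) → 0ᴿ +ᴿ r ≋ r
+-identityˡ r
  = ⟨ (λ (a , b , a<0 , b<r , p≤) → lowered r (ℚ.<⇒≤ (+-neg-< (<0⇒neg a<0) p≤)) b<r) ⟩
  -- Only negative rationals lie below `0ᴿ`, so the left share must be strictly negative:
  -- roundedness supplies q above p, and p - q is that share.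
  , ⟨ (λ {p} p<r → let (q , p<q , q<r) = rounded r p<r in
        p ℚ.- q , q
        , lift (inj₁ (subst (p ℚ.- q ℚ.<_) (ℚ.+-inverseʳ q) (ℚ.+-monoˡ-< (ℚ.- q) p<q)))
        , q<r , ℚ.≤-reflexive (solve 2 (λ p q → p := p :- q :+ q) refl p q)) ⟩
  where open +-*-Solver

+-identityʳ : (r : ℝ₊∞ ℓ) → r +ᴿ 0ᴿ ≋ r
+-identityʳ r = ≋-trans (+-comm r 0ᴿ) (+-identityˡ r)

+-commutativeMonoid : ∀ ℓ → CommutativeMonoid (lsuc ℓ) ℓ
+-commutativeMonoid ℓ = record
  { Carrier = ℝ₊∞ ℓ
  ; _≈_ = _≋_
  ; _∙_ = _+ᴿ_
  ; ε = 0ᴿ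
  ; isCommutativeMonoid = record
    { isMonoid = record
      { isSemigroup = record
        { isMagma = record { isEquivalence = Poset.isEquivalence (≼-poset ℓ) ; ∙-cong = +-cong }
        ; assoc = +-assoc
        }
      ; identity = +-identityˡ , +-identityʳ
      }
    ; comm = +-comm
    }
  }

r≼r+s : (r s : ℝ₊∞ ℓ) → r ≼ r +ᴿ s
r≼r+s r s = ≼-trans (≋⇒≽ (+-identityʳ r)) (+-mono (≼-refl {r = r}) (0≼ s))

s≼r+s : (r s : ℝ₊∞ ℓ) → s ≼ r +ᴿ s
s≼r+s r s = ≼-trans (≋⇒≽ (+-identityˡ s)) (+-mono (0≼ r) (≼-refl {r = s}))

sumᴿ-cong : ∀ n {r s : Fin n → ℝ₊∞ ℓ} → (∀ i → r i ≋ s i) → sumᴿ n r ≋ sumᴿ n s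
sumᴿ-cong zero    r≋s = ≋-refl
sumᴿ-cong (suc n) r≋s = +-cong (r≋s zero) (sumᴿ-cong n (r≋s ∘ suc))

sumᴿ-mono : ∀ n {r s : Fin n → ℝ₊∞ ℓ} → (∀ i → r i ≼ s i) → sumᴿ n r ≼ sumᴿ n s
sumᴿ-mono zero    r≼s = ≼-refl
sumᴿ-mono (suc n) r≼s = +-mono (r≼s zero) (sumᴿ-mono n (r≼s ∘ suc))

-- Multiplication of lower reals

*-mono : {r r′ s s′ : ℝ₊∞ ℓ} → r ≼ r′ → s ≼ s′ → r *ᴿ s ≼ r′ *ᴿ s′
*-mono ⟨ f ⟩ ⟨ g ⟩ = ⟨ (λ
  { (inj₁ p<0) → inj₁ p<0
  ; (inj₂ (a , b , 0≤a , 0≤b , a<r , b<s , p<)) → inj₂ (a , b , 0≤a , 0≤b , f a<r , g b<s , p<) }) ⟩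

*-cong : {r r′ s s′ : ℝ₊∞ ℓ} → r ≋ r′ → s ≋ s′ → r *ᴿ s ≋ r′ *ᴿ s′
*-cong (a , b) (c , d) = *-mono a c , *-mono b d

*-comm-≼ : (r s : ℝ₊∞ ℓ) → r *ᴿ s ≼ s *ᴿ r
*-comm-≼ r s = ⟨ (λ
  { (inj₁ p<0) → inj₁ p<0
  ; {p} (inj₂ (a , b , 0≤a , 0≤b , a<r , b<s , p<)) →
      inj₂ (b , a , 0≤b , 0≤a , b<s , a<r , subst (p ℚ.<_) (ℚ.*-comm a b) p<) }) ⟩

*-comm : (r s : ℝ₊∞ ℓ) → r *ᴿ s ≋ s *ᴿ r
*-comm r s = *-comm-≼ r s , *-comm-≼ s r

-- The product cut asks for a strict inequality below the product of its witnesses, so roundedness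
-- first enlarges both factors.
*-intro : (r s : ℝ₊∞ ℓ) → ∀ {a b} → 0ℚ ℚ.≤ a → 0ℚ ℚ.≤ b → a <ᶜ r → b <ᶜ s → a ℚ.* b <ᶜ r *ᴿ s
*-intro r s 0≤a 0≤b a<r b<s =
  let (a′ , a<a′ , a′<r) = rounded r a<r
      (b′ , b<b′ , b′<s) = rounded s b<s
  in inj₂ (a′ , b′ , ℚ.≤-trans 0≤a (ℚ.<⇒≤ a<a′) , ℚ.≤-trans 0≤b (ℚ.<⇒≤ b<b′)
          , a′<r , b′<s , *-mono-<-nonNeg 0≤a a<a′ 0≤b b<b′)

-- A negative b is no witness for the product cut, but then a · b is negative and lies in every cut.
-- This needs a to be nonzero: for a = 0 the product would be 0, which need not lie below r · s.
*-intro-pos : (r s : ℝ₊∞ ℓ) → ∀ {a b} → 0ℚ ℚ.< a → a <ᶜ r → b <ᶜ s → a ℚ.* b <ᶜ r *ᴿ s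
*-intro-pos r s {a} {b} 0<a a<r b<s with 0ℚ ℚ.≤? b
... | yes 0≤b = *-intro r s (ℚ.<⇒≤ 0<a) 0≤b a<r b<s
... | no  0≰b = negative (r *ᴿ s) (subst (a ℚ.* b ℚ.<_) (ℚ.*-zeroʳ a)
                  (ℚ.*-monoʳ-<-pos a {{ℚ.positive 0<a}} (ℚ.≰⇒> 0≰b)))

*-assoc-≼ : (r s t : ℝ₊∞ ℓ) → r *ᴿ s *ᴿ t ≼ r *ᴿ (s *ᴿ t)
*-assoc-≼ r s t = ⟨ (λ
  { (inj₁ p<0) → inj₁ p<0
  ; (inj₂ (u , b , 0≤u , _ , inj₁ (lift u<0) , _)) → contradiction 0≤u (<⇒≱ u<0)
  ; (inj₂ (u , b , _ , 0≤b , inj₂ (c , d , 0≤c , 0≤d , c<r , d<s , u<cd) , b<t , p<ub)) →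
      lowered (r *ᴿ (s *ᴿ t))
        (ℚ.≤-trans (ℚ.<⇒≤ p<ub)
          (ℚ.≤-trans (ℚ.*-monoʳ-≤-nonNeg b {{ℚ.nonNegative 0≤b}} (ℚ.<⇒≤ u<cd))
            (ℚ.≤-reflexive (ℚ.*-assoc c d b))))
        (*-intro r (s *ᴿ t) 0≤c (*-nonNeg 0≤d 0≤b) c<r (*-intro s t 0≤d 0≤b d<s b<t)) }) ⟩

*-assoc : (r s t : ℝ₊∞ ℓ) → r *ᴿ s *ᴿ t ≋ r *ᴿ (s *ᴿ t)
*-assoc r s t = *-assoc-≼ r s t , (begin
  r *ᴿ (s *ᴿ t)  ≈⟨ *-comm r (s *ᴿ t) ⟩
  s *ᴿ t *ᴿ r    ≤⟨ *-assoc-≼ s t r ⟩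
  s *ᴿ (t *ᴿ r)  ≈⟨ *-comm s (t *ᴿ r) ⟩
  t *ᴿ r *ᴿ s    ≤⟨ *-assoc-≼ t r s ⟩
  t *ᴿ (r *ᴿ s)  ≈⟨ *-comm t (r *ᴿ s) ⟩
  r *ᴿ s *ᴿ t    ∎)
  where open ≼-Reasoning

*-zeroʳ : (r : ℝ₊∞ ℓ) → r *ᴿ 0ᴿ ≋ 0ᴿ
*-zeroʳ r = ⟨ (λ
  { (inj₁ (lift p<0)) → lift (inj₁ p<0)
  ; (inj₂ (_ , _ , _ , 0≤b , _ , b<0 , _)) → contradiction 0≤b (<⇒≱ (<0⇒neg b<0)) }) ⟩
  , 0≼ _

*-distribˡ-+ : (r s t : ℝ₊∞ ℓ) → r *ᴿ (s +ᴿ t) ≋ r *ᴿ s +ᴿ r *ᴿ t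
*-distribˡ-+ r s t = ⟨ to ⟩ , ⟨ from ⟩
  where
  to : ∀ {p} → p <ᶜ r *ᴿ (s +ᴿ t) → p <ᶜ r *ᴿ s +ᴿ r *ᴿ t
  to (inj₁ (lift p<0)) = negative (r *ᴿ s +ᴿ r *ᴿ t) p<0
  to {p} (inj₂ (a , b , 0≤a , 0≤b , a<r , (c , d , c<s , d<t , b≤c+d) , p<ab)) =
    -- One of c and d may be negative, so `*-intro-pos` is used, which needs a strictly positive
    -- left factor.
    let (a′ , a<a′ , a′<r) = rounded r a<r
        0<a′ = ℚ.≤-<-trans 0≤a a<a′
    in a′ ℚ.* c , a′ ℚ.* d , *-intro-pos r s 0<a′ a′<r c<s , *-intro-pos r t 0<a′ a′<r d<t
       , ℚ.≤-trans (ℚ.<⇒≤ p<ab)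
         (ℚ.≤-trans (*-mono-nonNeg 0≤a (ℚ.<⇒≤ a<a′) 0≤b b≤c+d)
           (ℚ.≤-reflexive (ℚ.*-distribˡ-+ a′ c d)))
  -- The two products arrive with different left factors; as c and d are nonnegative, both factors
  -- can be raised to the larger one before distributing.
  same-factor : ∀ {p a b c d} → 0ℚ ℚ.≤ c → 0ℚ ℚ.≤ d → 0ℚ ℚ.≤ a → a ℚ.≤ b → b <ᶜ r → c <ᶜ s → d <ᶜ t →
                p ℚ.≤ b ℚ.* c ℚ.+ b ℚ.* d → p <ᶜ r *ᴿ (s +ᴿ t)
  same-factor {b = b} {c} {d} 0≤c 0≤d 0≤a a≤b b<r c<s d<t p≤ =
    lowered (r *ᴿ (s +ᴿ t))
      (ℚ.≤-trans p≤ (ℚ.≤-reflexive (sym (ℚ.*-distribˡ-+ b c d))))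
      (*-intro r (s +ᴿ t) (ℚ.≤-trans 0≤a a≤b) (ℚ.+-mono-≤ 0≤c 0≤d) b<r (c , d , c<s , d<t , ℚ.≤-refl))
  from : ∀ {p} → p <ᶜ r *ᴿ s +ᴿ r *ᴿ t → p <ᶜ r *ᴿ (s +ᴿ t)
  -- A negative share contributes nothing, so the other product alone suffices.
  from (u , v , inj₁ (lift u<0) , v< , p≤) =
    at (*-mono (≼-refl {r = r}) (s≼r+s s t)) (lowered (r *ᴿ t) (ℚ.<⇒≤ (+-neg-< u<0 p≤)) v<)
  from {p} (u , v , u<@(inj₂ _) , inj₁ (lift v<0) , p≤) =
    at (*-mono (≼-refl {r = r}) (r≼r+s s t))
      (lowered (r *ᴿ s) (ℚ.<⇒≤ (+-neg-< v<0 (subst (p ℚ.≤_) (ℚ.+-comm u v) p≤))) u<)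
  from (u , v , inj₂ (a , c , 0≤a , 0≤c , a<r , c<s , u<ac) , inj₂ (b , d , 0≤b , 0≤d , b<r , d<t , v<bd) , p≤)
    with ℚ.≤-total a b
  ... | inj₁ a≤b = same-factor 0≤c 0≤d 0≤a a≤b b<r c<s d<t (ℚ.≤-trans p≤ (ℚ.+-mono-≤
          (ℚ.≤-trans (ℚ.<⇒≤ u<ac) (ℚ.*-monoʳ-≤-nonNeg c {{ℚ.nonNegative 0≤c}} a≤b)) (ℚ.<⇒≤ v<bd)))
  ... | inj₂ b≤a = same-factor 0≤c 0≤d 0≤b b≤a a<r c<s d<t (ℚ.≤-trans p≤ (ℚ.+-mono-≤
          (ℚ.<⇒≤ u<ac) (ℚ.≤-trans (ℚ.<⇒≤ v<bd) (ℚ.*-monoʳ-≤-nonNeg d {{ℚ.nonNegative 0≤d}} b≤a))))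

*-left-comm : (r s t : ℝ₊∞ ℓ) → r *ᴿ (s *ᴿ t) ≋ s *ᴿ (r *ᴿ t)
*-left-comm r s t = begin-equality
  r *ᴿ (s *ᴿ t)  ≈⟨ *-assoc r s t ⟨
  r *ᴿ s *ᴿ t    ≈⟨ *-cong (*-comm r s) ≋-refl ⟩
  s *ᴿ r *ᴿ t    ≈⟨ *-assoc s r t ⟩
  s *ᴿ (r *ᴿ t)  ∎
  where open ≼-Reasoning

-- Rationals as lower reals

fromℚ-< : ∀ {p a} → p ℚ.< a → p <ᶜ fromℚ {ℓ} a
fromℚ-< p<a = lift (inj₂ p<a)

fromℚ-<⁻¹ : ∀ {p a} → 0ℚ ℚ.≤ a → p <ᶜ fromℚ {ℓ} a → p ℚ.< a
fromℚ-<⁻¹ 0≤a (lift (inj₁ p<0)) = ℚ.<-≤-trans p<0 0≤a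
fromℚ-<⁻¹ 0≤a (lift (inj₂ p<a)) = p<a

fromℚ-≼ : (r : ℝ₊∞ ℓ) → ∀ {a} → a <ᶜ r → fromℚ a ≼ r
fromℚ-≼ r a<r = ⟨ (λ
  { (lift (inj₁ p<0)) → negative r p<0
  ; (lift (inj₂ p<a)) → lowered r (ℚ.<⇒≤ p<a) a<r }) ⟩

fromℚ-mono : ∀ {a b} → a ℚ.≤ b → fromℚ {ℓ} a ≼ fromℚ b
fromℚ-mono a≤b = ⟨ (λ
  { (lift (inj₁ p<0)) → lift (inj₁ p<0)
  ; (lift (inj₂ p<a)) → lift (inj₂ (ℚ.<-≤-trans p<a a≤b)) }) ⟩

fromℚ-+-≼ : ∀ a b → fromℚ {ℓ} (a ℚ.+ b) ≼ fromℚ a +ᴿ fromℚ b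
fromℚ-+-≼ a b = ⟨ (λ
  { (lift (inj₁ p<0)) → negative (fromℚ a +ᴿ fromℚ b) p<0
  ; (lift (inj₂ p<a+b)) → let (u , v , u<a , v<b , p≤) = <-split p<a+b in
      u , v , fromℚ-< u<a , fromℚ-< v<b , p≤ }) ⟩

-- Multiplying by a positive rational a amounts to rescaling the cut by its inverse c, which avoids
-- pairs of witnesses. `fromℚ-*-intro` is the converse.
fromℚ-*-elim : (r : ℝ₊∞ ℓ) → ∀ {a c p} → 0ℚ ℚ.< c → c ℚ.* a ≡ 1ℚ →
                  p <ᶜ fromℚ a *ᴿ r → c ℚ.* p <ᶜ r
fromℚ-*-elim r {c = c} {p} 0<c ca≡1 (inj₁ (lift p<0)) =
  negative r (subst (c ℚ.* p ℚ.<_) (ℚ.*-zeroʳ c) (ℚ.*-monoʳ-<-pos c {{ℚ.positive 0<c}} p<0))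
fromℚ-*-elim r {a} {c} {p} 0<c ca≡1 (inj₂ (a′ , b , 0≤a′ , 0≤b , a′<a , b<r , p<a′b)) =
  lowered r (ℚ.≤-trans (ℚ.*-monoˡ-≤-nonNeg c {{nonNeg-c}} (ℚ.≤-trans (ℚ.<⇒≤ p<a′b)
      (ℚ.*-monoʳ-≤-nonNeg b {{ℚ.nonNegative 0≤b}} (a′≤a a′<a))))
    (ℚ.≤-reflexive (cancel-reciprocal {a} {c} b ca≡1))) b<r
  where
  nonNeg-c = ℚ.nonNegative (ℚ.<⇒≤ 0<c)
  a′≤a : a′ <ᶜ fromℚ a → a′ ℚ.≤ a
  a′≤a (lift (inj₁ a′<0)) = contradiction 0≤a′ (<⇒≱ a′<0)
  a′≤a (lift (inj₂ a′<a)) = ℚ.<⇒≤ a′<a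

fromℚ-*-intro : (r : ℝ₊∞ ℓ) → ∀ {a c p} → 0ℚ ℚ.< a → c ℚ.* a ≡ 1ℚ →
                 c ℚ.* p <ᶜ r → p <ᶜ fromℚ a *ᴿ r
fromℚ-*-intro r {a} {c} {p} 0<a ca≡1 cp<r with 0ℚ ℚ.≤? p
... | no  0≰p = inj₁ (lift (ℚ.≰⇒> 0≰p))
... | yes 0≤p =
  -- p is factored as (p / q) · q with q slightly above c p. Then p / q < a, because p = a (c p) < a
  -- q; and q is positive even when p = 0.
  let (q , cp<q , q<r) = rounded r cp<r
      0<q = ℚ.≤-<-trans 0≤cp cp<q
      (d , 0<d , dq≡1) = reciprocal 0<q
      dp<a : d ℚ.* p ℚ.< a
      dp<a = subst (d ℚ.* p ℚ.<_) (cancel-reciprocal {q} {d} a dq≡1)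
        (ℚ.*-monoʳ-<-pos d {{ℚ.positive 0<d}}
          (subst₂ ℚ._<_ (cancel-reciprocal {c} {a} p (trans (ℚ.*-comm a c) ca≡1)) (ℚ.*-comm a q)
            (ℚ.*-monoʳ-<-pos a {{ℚ.positive 0<a}} cp<q)))
  in lowered (fromℚ a *ᴿ r)
       (ℚ.≤-reflexive (trans (sym (cancel-reciprocal {q} {d} p dq≡1))
         (solve 3 (λ d q p → d :* (q :* p) := d :* p :* q) refl d q p)))
       (*-intro (fromℚ a) r (*-nonNeg (ℚ.<⇒≤ 0<d) 0≤p) (ℚ.<⇒≤ 0<q) (fromℚ-< dp<a) q<r)
  where
  open +-*-Solver
  0≤c : 0ℚ ℚ.≤ c
  0≤c = ℚ.≮⇒≥ (λ c<0 → ℚ.<-asym {1ℚ} {0ℚ} (subst₂ ℚ._<_ ca≡1 (ℚ.*-zeroˡ a)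
    (ℚ.*-monoˡ-<-pos a {{ℚ.positive 0<a}} c<0)) (ℚ.positive⁻¹ 1ℚ))
  0≤cp : 0ℚ ℚ.≤ c ℚ.* p
  0≤cp = *-nonNeg 0≤c 0≤p

*-identityˡ : (r : ℝ₊∞ ℓ) → 1ᴿ *ᴿ r ≋ r
*-identityˡ r
  = ⟨ (λ {p} c → subst (cut r) (ℚ.*-identityˡ p) (fromℚ-*-elim r (ℚ.positive⁻¹ 1ℚ) refl c)) ⟩
  , ⟨ (λ {p} c → fromℚ-*-intro r (ℚ.positive⁻¹ 1ℚ) refl (subst (cut r) (sym (ℚ.*-identityˡ p)) c)) ⟩

*-identityʳ : (r : ℝ₊∞ ℓ) → r *ᴿ 1ᴿ ≋ r
*-identityʳ r = ≋-trans (*-comm r 1ᴿ) (*-identityˡ r)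

fromℚ-* : ∀ {a b} → 0ℚ ℚ.< a → 0ℚ ℚ.< b → fromℚ {ℓ} (a ℚ.* b) ≋ fromℚ a *ᴿ fromℚ b
fromℚ-* {a = a} {b} 0<a 0<b =
  let (c , 0<c , ca≡1) = reciprocal 0<a in
    ⟨ (λ {p} p<ab → fromℚ-*-intro (fromℚ b) {a} {c} {p} 0<a ca≡1 (fromℚ-<
        (subst (c ℚ.* p ℚ.<_) (cancel-reciprocal {a} {c} b ca≡1)
          (ℚ.*-monoʳ-<-pos c {{ℚ.positive 0<c}} (fromℚ-<⁻¹ (ℚ.<⇒≤ (*-pos 0<a 0<b)) p<ab))))) ⟩
  , ⟨ (λ {p} p< → fromℚ-< (subst (ℚ._< a ℚ.* b)
        (cancel-reciprocal {c} {a} p (trans (ℚ.*-comm a c) ca≡1))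
        (ℚ.*-monoʳ-<-pos a {{ℚ.positive 0<a}}
          (fromℚ-<⁻¹ (ℚ.<⇒≤ 0<b) (fromℚ-*-elim (fromℚ b) {a} {c} {p} 0<c ca≡1 p<))))) ⟩

-- Common units of rationals

·-nonNeg : ∀ n {e} → 0ℚ ℚ.< e → 0ℚ ℚ.≤ n · e
·-nonNeg zero    0<e = ℚ.≤-refl
·-nonNeg (suc n) 0<e = ℚ.+-mono-≤ (ℚ.<⇒≤ 0<e) (·-nonNeg n 0<e)

p≤p+n·e : ∀ p n {e} → 0ℚ ℚ.< e → p ℚ.≤ p ℚ.+ n · e
p≤p+n·e p n {e} 0<e = subst (ℚ._≤ p ℚ.+ n · e) (ℚ.+-identityʳ p) (ℚ.+-monoʳ-≤ p (·-nonNeg n 0<e))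

IsMultipleOf : ℚ → ℚ → Set
IsMultipleOf e d = ∃ λ n → d ≡ n · e

multiple-trans : ∀ {e e′ d} → IsMultipleOf e e′ → IsMultipleOf e′ d → IsMultipleOf e d
multiple-trans {e} (m , refl) (n , refl) = n ℕ.* m , ×-assocˡ e n m

unit≤multiple : ∀ {e d} → 0ℚ ℚ.< e → 0ℚ ℚ.< d → IsMultipleOf e d → e ℚ.≤ d
unit≤multiple 0<e 0<d (zero  , refl) = contradiction 0<d (ℚ.<-irrefl refl)
unit≤multiple 0<e 0<d (suc n , refl) = p≤p+n·e _ n 0<e

-- Addition in ℚ normalises its result, so the induction step is checked on unnormalised fractions,
-- where it is an identity of integers.
n·1/q : ∀ n q → n · (+ 1 ℚ./ suc q) ≡ + n ℚ./ suc q
n·1/q zero    q = ℚ.fromℚᵘ-cong {mkℚᵘ (+ 0) 0} {mkℚᵘ (+ 0) q} (*≡* refl)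
n·1/q (suc n) q = trans (cong (+ 1 ℚ./ suc q ℚ.+_) (n·1/q n q)) (ℚ.toℚᵘ-injective (begin-equality
  ℚ.toℚᵘ (+ 1 ℚ./ suc q ℚ.+ + n ℚ./ suc q)
    ≃⟨ ℚ.toℚᵘ-homo-+ (+ 1 ℚ./ suc q) (+ n ℚ./ suc q) ⟩
  ℚ.toℚᵘ (+ 1 ℚ./ suc q) ℚᵘ.+ ℚ.toℚᵘ (+ n ℚ./ suc q)
    ≃⟨ ℚᵘ.+-cong (ℚ.toℚᵘ-fromℚᵘ (mkℚᵘ (+ 1) q)) (ℚ.toℚᵘ-fromℚᵘ (mkℚᵘ (+ n) q)) ⟩
  mkℚᵘ (+ 1) q ℚᵘ.+ mkℚᵘ (+ n) q
    ≃⟨ *≡* (solve 2 (λ n q → (con (+ 1) :* q :+ n :* q) :* q := (con (+ 1) :+ n) :* (q :* q))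
                    refl (+ n) (+ suc q)) ⟩
  mkℚᵘ (+ suc n) q
    ≃⟨ ℚ.toℚᵘ-fromℚᵘ (mkℚᵘ (+ suc n) q) ⟨
  ℚ.toℚᵘ (+ suc n ℚ./ suc q) ∎))
  where
  open ℚᵘ.≤-Reasoning
  open ℤ.+-*-Solver

-- The unit is the reciprocal of the denominator of d. That 1 is a multiple of it too is what lets
-- `common-unit₂` multiply units.
as-fraction : ∀ {d} → 0ℚ ℚ.< d → ∃ λ w → 0ℚ ℚ.< w × IsMultipleOf w d × IsMultipleOf w 1ℚ
as-fraction {d} 0<d with d | ℚ.positive 0<d
... | d@(mkℚ +[1+ p ] q-1 _) | _ =
    + 1 ℚ./ suc q-1
  , ℚ.positive⁻¹ _ {{ℚ.normalize-pos 1 (suc q-1)}}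
  , (suc p , trans (sym (ℚ.↥p/↧p≡p d)) (sym (n·1/q (suc p) q-1)))
  , (suc q-1 , trans (ℚ.fromℚᵘ-cong {mkℚᵘ (+ 1) 0} {mkℚᵘ (+ suc q-1) q-1} (*≡* (ℤ.*-comm (+ 1) (+ suc q-1))))
                     (sym (n·1/q (suc q-1) q-1)))

-- If 1 = n · v then w = n · (w v), so the product of the two units measures w, and symmetrically v.
-- No greatest common divisor has to be computed.
common-unit₂ : ∀ {a b} → 0ℚ ℚ.< a → 0ℚ ℚ.< b →
               ∃ λ e → 0ℚ ℚ.< e × IsMultipleOf e a × IsMultipleOf e b
common-unit₂ 0<a 0<b with as-fraction 0<a | as-fraction 0<b
... | w , 0<w , w∣a , (m , 1≡mw) | v , 0<v , v∣b , (n , 1≡nv) =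
  w ℚ.* v , *-pos 0<w 0<v
  , multiple-trans (n , trans (sym (ℚ.*-identityʳ w)) (trans (cong (w ℚ.*_) 1≡nv) (×-comm-* n w v))) w∣a
  , multiple-trans (m , trans (sym (ℚ.*-identityˡ v)) (trans (cong (ℚ._* v) 1≡mw) (×-assoc-* m w v))) v∣b

common-unit : (ds : Steps) → ∃ λ e → 0ℚ ℚ.< e × All (IsMultipleOf e ∘ proj₁) ds
common-unit []                = 1ℚ , ℚ.positive⁻¹ 1ℚ , []
common-unit ((d , d-pos) ∷ ds) =
  let (e′ , 0<e′ , e′∣ds)     = common-unit ds
      (e , 0<e , e∣d , e∣e′) = common-unit₂ (ℚ.positive⁻¹ d {{d-pos}}) 0<e′
  in e , 0<e , e∣d ∷ All.map (multiple-trans e∣e′) e′∣ds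

-- Lower Darboux sums

*-distribʳ-+ : (r s t : ℝ₊∞ ℓ) → (r +ᴿ s) *ᴿ t ≋ r *ᴿ t +ᴿ s *ᴿ t
*-distribʳ-+ r s t = begin-equality
  (r +ᴿ s) *ᴿ t       ≈⟨ *-comm (r +ᴿ s) t ⟩
  t *ᴿ (r +ᴿ s)       ≈⟨ *-distribˡ-+ t r s ⟩
  t *ᴿ r +ᴿ t *ᴿ s    ≈⟨ +-cong (*-comm t r) (*-comm t s) ⟩
  r *ᴿ t +ᴿ s *ᴿ t    ∎
  where open ≼-Reasoning

+-interchange : (r s t u : ℝ₊∞ ℓ) → (r +ᴿ s) +ᴿ (t +ᴿ u) ≋ (r +ᴿ t) +ᴿ (s +ᴿ u)
+-interchange {ℓ} = Algebra.Properties.CommutativeSemigroup.interchange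
  (CommutativeMonoid.commutativeSemigroup (+-commutativeMonoid ℓ))

lowerSum-≼ : {g g′ : ℚ → ℝ₊∞ ℓ} → (∀ t → g t ≼ g′ t) → ∀ a ds → lowerSum g a ds ≼ lowerSum g′ a ds
lowerSum-≼ g≼g′ a ds = ⟨ lowerSum-mono (λ t p → at (g≼g′ t)) a ds _ ⟩

lowerSum-0 : ∀ a ds → lowerSum {ℓ} (λ _ → 0ᴿ) a ds ≋ 0ᴿ
lowerSum-0 a []             = ≋-refl
lowerSum-0 a ((d , _) ∷ ds) =
  ≋-trans (+-cong (*-zeroʳ (fromℚ d)) (lowerSum-0 (a ℚ.+ d) ds)) (+-identityˡ 0ᴿ)

lowerSum-+ : (g g′ : ℚ → ℝ₊∞ ℓ) → ∀ a ds →
             lowerSum (λ t → g t +ᴿ g′ t) a ds ≋ lowerSum g a ds +ᴿ lowerSum g′ a ds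
lowerSum-+ g g′ a []             = ≋-sym (+-identityˡ 0ᴿ)
lowerSum-+ g g′ a ((d , _) ∷ ds) = let b = a ℚ.+ d in ≋-trans
  (+-cong (*-distribˡ-+ (fromℚ d) (g b) (g′ b)) (lowerSum-+ g g′ b ds))
  (+-interchange (fromℚ d *ᴿ g b) (fromℚ d *ᴿ g′ b) (lowerSum g b ds) (lowerSum g′ b ds))

lowerSum-* : (r : ℝ₊∞ ℓ) (g : ℚ → ℝ₊∞ ℓ) → ∀ a ds →
             lowerSum (λ t → r *ᴿ g t) a ds ≋ r *ᴿ lowerSum g a ds
lowerSum-* r g a []             = ≋-sym (*-zeroʳ r)
lowerSum-* r g a ((d , _) ∷ ds) = let b = a ℚ.+ d in ≋-trans
  (+-cong (*-left-comm (fromℚ d) r (g b)) (lowerSum-* r g b ds))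
  (≋-sym (*-distribˡ-+ r (fromℚ d *ᴿ g b) (lowerSum g b ds)))

lowerSum-++ˡ : (g : ℚ → ℝ₊∞ ℓ) → ∀ a xs ys → lowerSum g a xs ≼ lowerSum g a (xs ++ ys)
lowerSum-++ˡ g a []             ys = 0≼ _
lowerSum-++ˡ g a ((d , _) ∷ xs) ys =
  +-mono (≼-refl {r = fromℚ d *ᴿ g (a ℚ.+ d)}) (lowerSum-++ˡ g (a ℚ.+ d) xs ys)

Antitone : (ℚ → ℝ₊∞ ℓ) → Set ℓ
Antitone g = ∀ {s t} → s ℚ.≤ t → g t ≼ g s

uniform : (e : ℚ) → 0ℚ ℚ.< e → ℕ → Steps
uniform e 0<e n = replicate n (e , ℚ.positive 0<e)

uniform-+ : ∀ e 0<e m n → uniform e 0<e m ++ uniform e 0<e n ≡ uniform e 0<e (m ℕ.+ n)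
uniform-+ e 0<e zero    n = refl
uniform-+ e 0<e (suc m) n = cong (_ ∷_) (uniform-+ e 0<e m n)

-- The short steps evaluate g at points no further right than the end of the long step, where an
-- antitone g is at least as large. So subdividing can only raise a lower sum.
lowerSum-subdivide : {g : ℚ → ℝ₊∞ ℓ} → Antitone g → ∀ a e 0<e n ys →
  fromℚ (n · e) *ᴿ g (a ℚ.+ n · e) +ᴿ lowerSum g (a ℚ.+ n · e) ys ≼
  lowerSum g a (uniform e 0<e n ++ ys)
lowerSum-subdivide {g = g} anti a e 0<e zero ys rewrite ℚ.+-identityʳ a = begin
  0ᴿ *ᴿ g a +ᴿ lowerSum g a ys  ≈⟨ +-cong (≋-trans (*-comm 0ᴿ (g a)) (*-zeroʳ (g a))) (≋-refl {r = lowerSum g a ys}) ⟩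
  0ᴿ +ᴿ lowerSum g a ys         ≈⟨ +-identityˡ (lowerSum g a ys) ⟩
  lowerSum g a ys               ∎
  where open ≼-Reasoning
lowerSum-subdivide {g = g} anti a e 0<e (suc n) ys rewrite sym (ℚ.+-assoc a e (n · e)) = begin
  fromℚ (e ℚ.+ n · e) *ᴿ g c +ᴿ S
    ≤⟨ +-mono (*-mono (fromℚ-+-≼ e (n · e)) (≼-refl {r = g c})) (≼-refl {r = S}) ⟩
  (fromℚ e +ᴿ fromℚ (n · e)) *ᴿ g c +ᴿ S
    ≈⟨ +-cong (*-distribʳ-+ (fromℚ e) (fromℚ (n · e)) (g c)) (≋-refl {r = S}) ⟩
  fromℚ e *ᴿ g c +ᴿ fromℚ (n · e) *ᴿ g c +ᴿ S
    ≈⟨ +-assoc (fromℚ e *ᴿ g c) (fromℚ (n · e) *ᴿ g c) S ⟩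
  fromℚ e *ᴿ g c +ᴿ (fromℚ (n · e) *ᴿ g c +ᴿ S)
    ≤⟨ +-mono (*-mono (≼-refl {r = fromℚ e}) (anti (p≤p+n·e b n 0<e))) (lowerSum-subdivide {g = g} anti b e 0<e n ys) ⟩
  fromℚ e *ᴿ g b +ᴿ lowerSum g b (uniform e 0<e n ++ ys)
    ∎
  where
  open ≼-Reasoning
  b = a ℚ.+ e
  c = b ℚ.+ n · e
  S = lowerSum g c ys

-- N is chosen before g: it depends on the partition alone, so one uniform refinement serves all
-- antitone maps and all starting points.
lowerSum-refine : ∀ {ℓ} {e} (0<e : 0ℚ ℚ.< e) {ds} → All (IsMultipleOf e ∘ proj₁) ds →
  ∃ λ N → (g : ℚ → ℝ₊∞ ℓ) → Antitone g → ∀ a → lowerSum g a ds ≼ lowerSum g a (uniform e 0<e N)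
lowerSum-refine 0<e []                 = 0 , λ g anti a → ≼-refl
lowerSum-refine {e = e} 0<e {(_ , n·e-pos) ∷ ds} ((n , refl) ∷ e∣ds) =
  let (N , refines) = lowerSum-refine 0<e e∣ds
  in n ℕ.+ N , λ g anti a → subst (λ es → lowerSum g a ((n · e , n·e-pos) ∷ ds) ≼ lowerSum g a es)
    (uniform-+ e 0<e n N)
    (≼-trans
      (+-mono (≼-refl {r = fromℚ (n · e) *ᴿ g (a ℚ.+ n · e)}) (refines g anti (a ℚ.+ n · e)))
      (lowerSum-subdivide anti a e 0<e n (uniform e 0<e N)))

-- Appending steps only adds nonnegative terms, so M + N steps dominate both refinements. As g is
-- quantified last, the two inequalities can be used for two different integrands.
common-refinement : ∀ {ℓ} ds ds′ → ∃ λ e → ∃ λ (0<e : 0ℚ ℚ.< e) → ∃ λ N →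
  (g : ℚ → ℝ₊∞ ℓ) → Antitone g →
  lowerSum g 0ℚ ds ≼ lowerSum g 0ℚ (uniform e 0<e N) × lowerSum g 0ℚ ds′ ≼ lowerSum g 0ℚ (uniform e 0<e N)
common-refinement {ℓ} ds ds′ =
  let (e , 0<e , e∣)       = common-unit (ds ++ ds′)
      (e∣ds , e∣ds′)       = All.++⁻ ds e∣
      (M , refines)        = lowerSum-refine 0<e e∣ds
      (N , refines′)       = lowerSum-refine 0<e e∣ds′
      extend : ∀ m n (g : ℚ → ℝ₊∞ _) → lowerSum g 0ℚ (uniform e 0<e m) ≼ lowerSum g 0ℚ (uniform e 0<e (m ℕ.+ n))
      extend m n g = subst (λ es → lowerSum g 0ℚ (uniform e 0<e m) ≼ lowerSum g 0ℚ es) (uniform-+ e 0<e m n)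
                       (lowerSum-++ˡ g 0ℚ (uniform e 0<e m) (uniform e 0<e n))
  in e , 0<e , M ℕ.+ N , λ g anti →
       ≼-trans (refines g anti 0ℚ) (extend M N g)
     , ≼-trans (refines′ g anti 0ℚ) (subst (λ k → lowerSum g 0ℚ (uniform e 0<e N) ≼ lowerSum g 0ℚ (uniform e 0<e k))
                                       (ℕ.+-comm N M) (extend N M g))

-- Riemann integrals

lowerSum≼riemann : (g : ℚ → ℝ₊∞ ℓ) → ∀ ds → lowerSum g 0ℚ ds ≼ riemann g
lowerSum≼riemann g ds = ⟨ (λ c → lift ds , c) ⟩

riemann-least : {g : ℚ → ℝ₊∞ ℓ} {r : ℝ₊∞ ℓ} → (∀ ds → lowerSum g 0ℚ ds ≼ r) → riemann g ≼ r
riemann-least below = ⟨ (λ (ds , c) → at (below (lower ds)) c) ⟩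

riemann-≼ : {g g′ : ℚ → ℝ₊∞ ℓ} → (∀ t → g t ≼ g′ t) → riemann g ≼ riemann g′
riemann-≼ {g = g} {g′} g≼g′ = riemann-least λ ds →
  ≼-trans (lowerSum-≼ g≼g′ 0ℚ ds) (lowerSum≼riemann g′ ds)

riemann-≋ : {g g′ : ℚ → ℝ₊∞ ℓ} → (∀ t → g t ≋ g′ t) → riemann g ≋ riemann g′
riemann-≋ g≋g′ = riemann-≼ (≋⇒≼ ∘ g≋g′) , riemann-≼ (≋⇒≽ ∘ g≋g′)

riemann-0 : riemann {ℓ} (λ _ → 0ᴿ) ≋ 0ᴿ
riemann-0 = riemann-least (≋⇒≼ ∘ lowerSum-0 0ℚ) , 0≼ _

-- This gives additivity in the valuation, not in the integrand. Lower sums over one partition add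
-- exactly; for antitone maps, two partitions can be replaced by a common refinement.
riemann-+ : {g g′ : ℚ → ℝ₊∞ ℓ} → Antitone g → Antitone g′ →
            riemann (λ t → g t +ᴿ g′ t) ≋ riemann g +ᴿ riemann g′
riemann-+ {g = g} {g′} anti anti′
  = riemann-least (λ ds → ≼-trans (≋⇒≼ (lowerSum-+ g g′ 0ℚ ds))
                                  (+-mono (lowerSum≼riemann g ds) (lowerSum≼riemann g′ ds)))
  , ⟨ (λ (a , b , (ds , a<) , (ds′ , b<) , p≤) →
        let (e , 0<e , N , refines) = common-refinement (lower ds) (lower ds′) in
        lift (uniform e 0<e N) , at (≋⇒≽ (lowerSum-+ g g′ 0ℚ (uniform e 0<e N)))
          (a , b , at (proj₁ (refines g anti)) a< , at (proj₂ (refines g′ anti′)) b< , p≤)) ⟩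

*-riemann-least : {r s : ℝ₊∞ ℓ} {g : ℚ → ℝ₊∞ ℓ} →
                  (∀ ds → r *ᴿ lowerSum g 0ℚ ds ≼ s) → r *ᴿ riemann g ≼ s
*-riemann-least {s = s} below = ⟨ (λ
  { (inj₁ (lift p<0)) → negative s p<0
  ; (inj₂ (a , b , 0≤a , 0≤b , a<r , (ds , b<) , p<)) →
      at (below (lower ds)) (inj₂ (a , b , 0≤a , 0≤b , a<r , b< , p<)) }) ⟩

riemann-* : (r : ℝ₊∞ ℓ) (g : ℚ → ℝ₊∞ ℓ) → riemann (λ t → r *ᴿ g t) ≋ r *ᴿ riemann g
riemann-* r g
  = riemann-least (λ ds → ≼-trans (≋⇒≼ (lowerSum-* r g 0ℚ ds))
                                  (*-mono (≼-refl {r = r}) (lowerSum≼riemann g ds)))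
  , *-riemann-least (λ ds → ≼-trans (≋⇒≽ (lowerSum-* r g 0ℚ ds))
                                    (lowerSum≼riemann (λ t → r *ᴿ g t) ds))

sumᴿ-antitone : ∀ n {G : Fin n → ℚ → ℝ₊∞ ℓ} → (∀ i → Antitone (G i)) → Antitone (λ t → sumᴿ n (λ i → G i t))
sumᴿ-antitone n anti s≤t = sumᴿ-mono n (λ i → anti i s≤t)

riemann-sumᴿ : ∀ n {G : Fin n → ℚ → ℝ₊∞ ℓ} → (∀ i → Antitone (G i)) →
               riemann (λ t → sumᴿ n (λ i → G i t)) ≋ sumᴿ n (λ i → riemann (G i))
riemann-sumᴿ zero    anti = riemann-0
riemann-sumᴿ (suc n) {G} anti = ≋-trans
  (riemann-+ (anti zero) (sumᴿ-antitone n (anti ∘ suc)))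
  (+-cong (≋-refl {r = riemann (G zero)}) (riemann-sumᴿ n (anti ∘ suc)))

-- Indicators and the integral against a Dirac valuation

indicator-mono : {A B : Set ℓ} → (A → B) → indicator A ≼ indicator B
indicator-mono f = ⟨ (λ { (inj₁ p<0) → inj₁ p<0 ; (inj₂ (a , p<1)) → inj₂ (f a , p<1) }) ⟩

1≼indicator : {A : Set ℓ} → A → 1ᴿ ≼ indicator A
1≼indicator a = ⟨ (λ { (lift (inj₁ p<0)) → inj₁ (lift p<0) ; (lift (inj₂ p<1)) → inj₂ (a , p<1) }) ⟩

indicator≼1 : {A : Set ℓ} → indicator A ≼ 1ᴿ
indicator≼1 = ⟨ (λ { (inj₁ (lift p<0)) → lift (inj₁ p<0) ; (inj₂ (a , p<1)) → lift (inj₂ p<1) }) ⟩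

scaled-indicator : ∀ {A : Set ℓ} {d p} → 0ℚ ℚ.< d → p <ᶜ fromℚ d *ᴿ indicator A →
                   p ℚ.< d × (p ℚ.< 0ℚ ⊎ A)
scaled-indicator {A = A} {d} {p} 0<d c = p<d , p<0⊎A c
  where
  p<d = fromℚ-<⁻¹ (ℚ.<⇒≤ 0<d) (at (≼-trans (*-mono (≼-refl {r = fromℚ d}) (indicator≼1 {A = A}))
                                           (≋⇒≼ (*-identityʳ (fromℚ d)))) c)
  p<0⊎A : p <ᶜ fromℚ d *ᴿ indicator A → p ℚ.< 0ℚ ⊎ A
  p<0⊎A (inj₁ (lift p<0)) = inj₁ p<0
  p<0⊎A (inj₂ (_ , _ , _ , 0≤b , _ , inj₁ (lift b<0) , _)) = contradiction 0≤b (<⇒≱ b<0)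
  p<0⊎A (inj₂ (_ , _ , _ , _ , _ , inj₂ (a , _) , _)) = inj₂ a

-- Only steps whose right end lies below r count, so the sum is at most the length r - a, written
-- additively since cuts cannot be subtracted. The alternative p < 0 covers the case that no step
-- counts.
lowerSum-indicator : (r : ℝ₊∞ ℓ) → ∀ a ds {p} → p <ᶜ lowerSum (λ t → indicator (t <ᶜ r)) a ds →
                     p ℚ.< 0ℚ ⊎ a ℚ.+ p <ᶜ r
lowerSum-indicator r a [] c = inj₁ (<0⇒neg c)
lowerSum-indicator r a ((d , d-pos) ∷ ds) {p} (u , v , u< , v< , p≤u+v)
  with scaled-indicator (ℚ.positive⁻¹ d {{d-pos}}) u< | lowerSum-indicator r (a ℚ.+ d) ds v<
... | u<d , _ | inj₂ a+d+v<r = inj₂ (lowered r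
        (ℚ.≤-trans (ℚ.+-monoʳ-≤ a (ℚ.≤-trans p≤u+v (ℚ.+-monoˡ-≤ v (ℚ.<⇒≤ u<d))))
          (ℚ.≤-reflexive (sym (ℚ.+-assoc a d v)))) a+d+v<r)
... | u<d , inj₂ a+d<r | inj₁ v<0 = inj₂ (lowered r
        (ℚ.+-monoʳ-≤ a (ℚ.<⇒≤ (ℚ.<-trans (+-neg-< v<0 (subst (p ℚ.≤_) (ℚ.+-comm u v) p≤u+v)) u<d))) a+d<r)
... | u<d , inj₁ u<0 | inj₁ v<0 = inj₁ (ℚ.<-trans (+-neg-< u<0 p≤u+v) v<0)

-- For r = h(x) the integrand is the Dirac valuation at x of { h > t }, so this is ∫ h dδ = h(x).
riemann-indicator : (r : ℝ₊∞ ℓ) → riemann (λ t → indicator (t <ᶜ r)) ≋ r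
riemann-indicator r = riemann-least (λ ds → ⟨ from ds ⟩) , ⟨ to ⟩
  where
  from : ∀ ds {p} → p <ᶜ lowerSum (λ t → indicator (t <ᶜ r)) 0ℚ ds → p <ᶜ r
  from ds {p} c with lowerSum-indicator r 0ℚ ds c
  ... | inj₁ p<0 = negative r p<0
  ... | inj₂ 0+p<r = subst (cut r) (ℚ.+-identityˡ p) 0+p<r
  to : ∀ {p} → p <ᶜ r → p <ᶜ riemann (λ t → indicator (t <ᶜ r))
  to {p} p<r with 0ℚ ℚ.≤? p | rounded r p<r
  ... | no  0≰p | _ = negative (riemann (λ t → indicator (t <ᶜ r))) (ℚ.≰⇒> 0≰p)
  -- The single step [0, q] is enough: its right end is still below r, so its lower sum is q, which
  -- exceeds p.
  ... | yes 0≤p | q , p<q , q<r = lift ((q , ℚ.positive (ℚ.≤-<-trans 0≤p p<q)) ∷ []) , at one-step (fromℚ-< p<q)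
    where
    open ≼-Reasoning
    A = 0ℚ ℚ.+ q <ᶜ r
    one-step : fromℚ q ≼ fromℚ q *ᴿ indicator A +ᴿ 0ᴿ
    one-step = begin
      fromℚ q                        ≈⟨ *-identityʳ (fromℚ q) ⟨
      fromℚ q *ᴿ 1ᴿ                  ≤⟨ *-mono (≼-refl {r = fromℚ q})
                                          (1≼indicator (subst (cut r) (sym (ℚ.+-identityˡ q)) q<r)) ⟩
      fromℚ q *ᴿ indicator A         ≤⟨ r≼r+s (fromℚ q *ᴿ indicator A) 0ᴿ ⟩
      fromℚ q *ᴿ indicator A +ᴿ 0ᴿ   ∎

-- Integration of Scott-continuous functions

fun-≼ : (h : X →ℝ₊∞) → ∀ {x y} → DCPO._≤_ X x y → fun h x ≼ fun h y
fun-≼ h x≤y = ⟨ IsScottContinuous.mono (scott h) x≤y _ ⟩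

scott-continuous : (X : DCPO ℓ) {f : DCPO.Carrier X → ℝ₊∞ ℓ} →
  (∀ {x y} → DCPO._≤_ X x y → f x ≼ f y) →
  ({I : Set ℓ} (s : I → DCPO.Carrier X) → IsDirected (DCPO.poset X) s →
   ∀ {x} → IsSup (DCPO.poset X) s x → ∀ {p} → p <ᶜ f x → ∃ λ i → p <ᶜ f (s i)) →
  IsScottContinuous ℓ (DCPO.poset X) (ℝ₊∞-poset ℓ) f
scott-continuous X mono approx = record
  { mono = λ x≤y _ → at (mono x≤y)
  ; sup  = λ s d l → record
    { bound = λ i _ → at (mono (IsSup.bound l i))
    ; least = λ r b p p<f → let (i , p<fᵢ) = approx s d l p<f in b i p p<fᵢ
    }
  }

fun-approx : {X : DCPO ℓ} (h : X →ℝ₊∞) {I : Set ℓ} (s : I → DCPO.Carrier X) → IsDirected (DCPO.poset X) s →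
  ∀ {x} → IsSup (DCPO.poset X) s x → ∀ {p} → p <ᶜ fun h x → ∃ λ i → p <ᶜ fun h (s i)
fun-approx h s d l = <ᶜ-sup (image-directed h d) (IsScottContinuous.sup (scott h) s d l)

0ᶠ : X →ℝ₊∞
0ᶠ {X = X} = record
  { fun = λ _ → 0ᴿ
  ; scott = scott-continuous X (λ _ → ≼-refl) (λ s d l c → IsDirected.inhabitant d , c) }

infixl 6 _+ᶠ_
infixl 7 _*ᶠ_

_+ᶠ_ : X →ℝ₊∞ → X →ℝ₊∞ → X →ℝ₊∞
_+ᶠ_ {X = X} h h′ = record
  { fun = λ x → fun h x +ᴿ fun h′ x
  ; scott = scott-continuous X (λ x≤y → +-mono (fun-≼ h x≤y) (fun-≼ h′ x≤y))
      (λ { s d l (a , b , a< , b< , p≤) →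
        let (i , a<ᵢ) = fun-approx h s d l a<
            (j , b<ⱼ) = fun-approx h′ s d l b<
            (k , i≤k , j≤k) = IsDirected.upper d i j
        in k , a , b , at (fun-≼ h i≤k) a<ᵢ , at (fun-≼ h′ j≤k) b<ⱼ , p≤ }) }

_*ᶠ_ : ℝ₊∞ ℓ → {X : DCPO ℓ} → X →ℝ₊∞ → X →ℝ₊∞
_*ᶠ_ r {X} h = record
  { fun = λ x → r *ᴿ fun h x
  ; scott = scott-continuous X (λ x≤y → *-mono (≼-refl {r = r}) (fun-≼ h x≤y))
      (λ { s d l (inj₁ p<0) → IsDirected.inhabitant d , inj₁ p<0
         ; s d l (inj₂ (a , b , 0≤a , 0≤b , a<r , b< , p<)) →
             let (i , b<ᵢ) = fun-approx h s d l b<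
             in i , inj₂ (a , b , 0≤a , 0≤b , a<r , b<ᵢ , p<) }) }

val-≼ : (ν : Valuation X) {U V : Open X} → (∀ x → mem U x → mem V x) → val ν U ≼ val ν V
val-≼ ν U⊆V = ⟨ IsScottContinuous.mono (continuous ν) U⊆V _ ⟩

val-empty : (ν : Valuation X) {U : Open X} → (∀ x → ¬ mem U x) → val ν U ≼ 0ᴿ
val-empty ν empty = ≼-trans (val-≼ ν {V = ∅ᵒ} λ x u → contradiction u (empty x)) ⟨ proj₁ (strict ν) _ ⟩

tail : (h : X →ℝ₊∞) (ν : Valuation X) → ℚ → ℝ₊∞ _
tail h ν t = val ν (superlevel h t)

tail-antitone : (h : X →ℝ₊∞) (ν : Valuation X) → Antitone (tail h ν)
tail-antitone h ν s≤t = val-≼ ν λ x → lowered (fun h x) s≤t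

∫-≼ : (h h′ : X →ℝ₊∞) (ν : Valuation X) → (∀ x → fun h x ≼ fun h′ x) → ∫ h ν ≼ ∫ h′ ν
∫-≼ h h′ ν h≼h′ = riemann-≼ λ t → val-≼ ν λ x → at (h≼h′ x)

∫-≋ : (h h′ : X →ℝ₊∞) (ν : Valuation X) → (∀ x → fun h x ≋ fun h′ x) → ∫ h ν ≋ ∫ h′ ν
∫-≋ h h′ ν h≋h′ = ∫-≼ h h′ ν (≋⇒≼ ∘ h≋h′) , ∫-≼ h′ h ν (≋⇒≽ ∘ h≋h′)

∫-val-≼ : (h : X →ℝ₊∞) {μ ν : Valuation X} → (∀ U → val μ U ≼ val ν U) → ∫ h μ ≼ ∫ h ν
∫-val-≼ h μ≼ν = riemann-≼ λ t → μ≼ν (superlevel h t)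

-- This is monotone convergence at the level of lower sums. A lower sum involves finitely many
-- thresholds; Scott-continuity of ν gives an index for each, and directedness, uniform in t, merges
-- them into one.
lowerSum-approx : {X : DCPO ℓ} (h : X →ℝ₊∞) (ν : Valuation X) {I : Set ℓ} (O : I → ℚ → Open X) → I →
  (∀ i j → ∃ λ k → (∀ t x → mem (O i t) x → mem (O k t) x) × (∀ t x → mem (O j t) x → mem (O k t) x)) →
  (∀ i t x → mem (O i t) x → t <ᶜ fun h x) →
  (∀ t x → t <ᶜ fun h x → ∃ λ i → mem (O i t) x) →
  ∀ a ds {p} → p <ᶜ lowerSum (tail h ν) a ds → ∃ λ i → p <ᶜ lowerSum (λ t → val ν (O i t)) a ds
lowerSum-approx h ν O i₀ upper below approx = lowerSum-sup (tail h ν) (λ i t → val ν (O i t)) i₀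
  (λ i j → let (k , i⊆k , j⊆k) = upper i j in
    k , (λ t _ → at (val-≼ ν (i⊆k t))) , (λ t _ → at (val-≼ ν (j⊆k t))))
  (λ t → <ᶜ-sup
    record { inhabitant = i₀
           ; upper = λ i j → let (k , i⊆k , j⊆k) = upper i j in
               k , (λ _ → at (val-≼ ν (i⊆k t))) , (λ _ → at (val-≼ ν (j⊆k t))) }
    (IsScottContinuous.sup (continuous ν) (λ i → O i t)
      record { inhabitant = i₀
             ; upper = λ i j → let (k , i⊆k , j⊆k) = upper i j in k , i⊆k t , j⊆k t }
      record { bound = λ i → below i t
             ; least = λ V b x t<h → let (i , o) = approx t x t<h in b i x o }))

-- Starting at a ≥ 0 keeps every threshold nonnegative; at a negative threshold the superlevel set
-- would be the whole space.
lowerSum-zero : (h : X →ℝ₊∞) (ν : Valuation X) → (∀ x → fun h x ≼ 0ᴿ) →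
                ∀ {a} → 0ℚ ℚ.≤ a → ∀ ds → lowerSum (tail h ν) a ds ≼ 0ᴿ
lowerSum-zero h ν h≼0 0≤a []                 = ≼-refl
lowerSum-zero h ν h≼0 {a} 0≤a ((d , d-pos) ∷ ds) = begin
  fromℚ d *ᴿ tail h ν b +ᴿ lowerSum (tail h ν) b ds
    ≤⟨ +-mono (*-mono (≼-refl {r = fromℚ d}) tail≼0) (lowerSum-zero h ν h≼0 0≤b ds) ⟩
  fromℚ d *ᴿ 0ᴿ +ᴿ 0ᴿ
    ≈⟨ +-identityʳ (fromℚ d *ᴿ 0ᴿ) ⟩
  fromℚ d *ᴿ 0ᴿ
    ≈⟨ *-zeroʳ (fromℚ d) ⟩
  0ᴿ ∎
  where
  open ≼-Reasoning
  b = a ℚ.+ d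
  0≤b : 0ℚ ℚ.≤ b
  0≤b = ℚ.+-mono-≤ 0≤a (ℚ.<⇒≤ (ℚ.positive⁻¹ d {{d-pos}}))
  tail≼0 : tail h ν b ≼ 0ᴿ
  tail≼0 = val-empty ν λ x b<h → <⇒≱ (<0⇒neg (at (h≼0 x) b<h)) 0≤b

∫-zero : (h : X →ℝ₊∞) (ν : Valuation X) → (∀ x → fun h x ≼ 0ᴿ) → ∫ h ν ≼ 0ᴿ
∫-zero h ν h≼0 = riemann-least (lowerSum-zero h ν h≼0 ℚ.≤-refl)

-- Layers of a list of opens

⊤ᵒ : Open X
⊤ᵒ = record { mem = λ _ → ⊤ ; upward = λ _ _ → tt ; inaccessible = λ s d _ _ → IsDirected.inhabitant d , tt }

-- The opens Wₖ, counting repeated list entries repeatedly. Whether x lies in V cannot be decided,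
-- so the count is a union of intersections, which is open by construction.
atLeast : ℕ → List (Open X) → Open X
atLeast zero    S       = ⊤ᵒ
atLeast (suc k) []      = ∅ᵒ
atLeast (suc k) (V ∷ S) = atLeast (suc k) S ∪ᵒ V ∩ᵒ atLeast k S

atLeast-pred : ∀ k (S : List (Open X)) {x} → mem (atLeast (suc k) S) x → mem (atLeast k S) x
atLeast-pred zero    S       _              = tt
atLeast-pred (suc k) (V ∷ S) (inj₁ m)       = inj₁ (atLeast-pred (suc k) S m)
atLeast-pred (suc k) (V ∷ S) (inj₂ (v , m)) = inj₂ (v , atLeast-pred k S m)

atLeast-∷ : ∀ k {V : Open X} S {x} → mem (atLeast k S) x → mem (atLeast k (V ∷ S)) x
atLeast-∷ zero    S _ = tt
atLeast-∷ (suc k) S m = inj₁ m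

atLeast-empty : ∀ k (S : List (Open X)) {x} → length S ℕ.< k → ¬ mem (atLeast k S) x
atLeast-empty (suc k) []      _             ()
atLeast-empty (suc k) (V ∷ S) (ℕ.s≤s ∣S∣<k) (inj₁ m)       = atLeast-empty (suc k) S (ℕ.m<n⇒m<1+n ∣S∣<k) m
atLeast-empty (suc k) (V ∷ S) (ℕ.s≤s ∣S∣<k) (inj₂ (_ , m)) = atLeast-empty k S ∣S∣<k m

atLeast-++⁺ : ∀ i j (S T : List (Open X)) {x} →
              mem (atLeast i S) x → mem (atLeast j T) x → mem (atLeast (i ℕ.+ j) (S ++ T)) x
atLeast-++⁺ zero    j []      T _              n = n
atLeast-++⁺ zero    j (V ∷ S) T _              n = atLeast-∷ j (S ++ T) (atLeast-++⁺ zero j S T tt n)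
atLeast-++⁺ (suc i) j (V ∷ S) T (inj₁ m)       n = inj₁ (atLeast-++⁺ (suc i) j S T m n)
atLeast-++⁺ (suc i) j (V ∷ S) T (inj₂ (v , m)) n = inj₂ (v , atLeast-++⁺ i j S T m n)

-- A membership proof selects k positions of the list, and these divide into positions in S and
-- positions in T.
atLeast-++⁻ : ∀ k (S T : List (Open X)) {x} → mem (atLeast k (S ++ T)) x →
              ∃ λ i → ∃ λ j → k ≡ i ℕ.+ j × mem (atLeast i S) x × mem (atLeast j T) x
atLeast-++⁻ k       []      T m        = 0 , k , refl , tt , m
atLeast-++⁻ zero    (V ∷ S) T m        = 0 , 0 , refl , tt , tt
atLeast-++⁻ (suc k) (V ∷ S) T (inj₁ m) =
  let (i , j , eq , mᵢ , mⱼ) = atLeast-++⁻ (suc k) S T m in i , j , eq , atLeast-∷ i S mᵢ , mⱼ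
atLeast-++⁻ (suc k) (V ∷ S) T (inj₂ (v , m)) =
  let (i , j , eq , mᵢ , mⱼ) = atLeast-++⁻ k S T m in suc i , j , cong suc eq , inj₂ (v , mᵢ) , mⱼ

sumVal : Valuation X → List (Open X) → ℝ₊∞ _
sumVal ν []      = 0ᴿ
sumVal ν (V ∷ S) = val ν V +ᴿ sumVal ν S

sumVal-++ : (ν : Valuation X) → ∀ S T → sumVal ν (S ++ T) ≋ sumVal ν S +ᴿ sumVal ν T
sumVal-++ ν []      T = ≋-sym (+-identityˡ (sumVal ν T))
sumVal-++ ν (V ∷ S) T = ≋-trans (+-cong (≋-refl {r = val ν V}) (sumVal-++ ν S T))
                                (≋-sym (+-assoc (val ν V) (sumVal ν S) (sumVal ν T)))

layerSum : Valuation X → List (Open X) → ℕ → ℕ → ℝ₊∞ _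
layerSum ν S k zero    = 0ᴿ
layerSum ν S k (suc n) = val ν (atLeast (suc k) S) +ᴿ layerSum ν S (suc k) n

+-right-comm : (r s t : ℝ₊∞ ℓ) → r +ᴿ s +ᴿ t ≋ r +ᴿ t +ᴿ s
+-right-comm r s t = ≋-trans (+-assoc r s t)
  (≋-trans (+-cong (≋-refl {r = r}) (+-comm s t)) (≋-sym (+-assoc r t s)))

-- Modularity telescopes: valuations cannot be subtracted, but the leftover
-- ν(V ∩ atLeast k S) of one layer is absorbed by the next.
layerSum-∷ : (ν : Valuation X) → ∀ V S k n →
  layerSum ν (V ∷ S) k n +ᴿ val ν (V ∩ᵒ atLeast (k ℕ.+ n) S) ≋ layerSum ν S k n +ᴿ val ν (V ∩ᵒ atLeast k S)
layerSum-∷ ν V S k zero rewrite ℕ.+-identityʳ k = ≋-refl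
layerSum-∷ ν V S k (suc n) rewrite ℕ.+-suc k n = begin-equality
  a +ᴿ L′ +ᴿ E     ≈⟨ +-assoc a L′ E ⟩
  a +ᴿ (L′ +ᴿ E)   ≈⟨ +-cong (≋-refl {r = a}) (layerSum-∷ ν V S (suc k) n) ⟩
  a +ᴿ (L +ᴿ B)    ≈⟨ +-assoc a L B ⟨
  a +ᴿ L +ᴿ B      ≈⟨ +-right-comm a L B ⟩
  a +ᴿ B +ᴿ L      ≈⟨ +-cong (+-cong (≋-refl {r = a}) B≋) (≋-refl {r = L}) ⟩
  a +ᴿ val ν (A ∩ᵒ W) +ᴿ L  ≈⟨ +-cong modular≋ (≋-refl {r = L}) ⟩
  val ν A +ᴿ val ν W +ᴿ L ≈⟨ +-right-comm (val ν A) (val ν W) L ⟩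
  val ν A +ᴿ L +ᴿ val ν W ∎
  where
  open ≼-Reasoning
  A = atLeast (suc k) S
  W = V ∩ᵒ atLeast k S
  a = val ν (A ∪ᵒ W)
  L = layerSum ν S (suc k) n
  L′ = layerSum ν (V ∷ S) (suc k) n
  B = val ν (V ∩ᵒ A)
  E = val ν (V ∩ᵒ atLeast (suc (k ℕ.+ n)) S)
  modular≋ : a +ᴿ val ν (A ∩ᵒ W) ≋ val ν A +ᴿ val ν W
  modular≋ = ≈⇒≋ (modular ν A W)
  B≋ : B ≋ val ν (A ∩ᵒ W)
  B≋ = val-≼ ν (λ x (v , m) → m , v , atLeast-pred k S m) , val-≼ ν (λ x (m , v , _) → v , m)

layerSum-[] : (ν : Valuation X) → ∀ k n → layerSum ν [] k n ≼ 0ᴿ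
layerSum-[] ν k zero    = ≼-refl
layerSum-[] ν k (suc n) = ≼-trans (+-mono (val-empty ν {∅ᵒ} λ _ ()) (layerSum-[] ν (suc k) n))
                                  (≋⇒≼ (+-identityˡ 0ᴿ))

-- In the telescoped identity at k = 0 the leftover on the right is ν(V), and the one on the left is
-- dropped.
layerSum≼sumVal : (ν : Valuation X) → ∀ S n → layerSum ν S 0 n ≼ sumVal ν S
layerSum≼sumVal ν []      n = layerSum-[] ν 0 n
layerSum≼sumVal ν (V ∷ S) n = begin
  layerSum ν (V ∷ S) 0 n                                ≤⟨ r≼r+s (layerSum ν (V ∷ S) 0 n) (val ν (V ∩ᵒ atLeast n S)) ⟩
  layerSum ν (V ∷ S) 0 n +ᴿ val ν (V ∩ᵒ atLeast n S)    ≈⟨ layerSum-∷ ν V S 0 n ⟩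
  layerSum ν S 0 n +ᴿ val ν (V ∩ᵒ ⊤ᵒ)                   ≤⟨ +-mono (layerSum≼sumVal ν S n) (val-≼ ν λ _ → proj₁) ⟩
  sumVal ν S +ᴿ val ν V                                 ≈⟨ +-comm (sumVal ν S) (val ν V) ⟩
  val ν V +ᴿ sumVal ν S                                 ∎
  where open ≼-Reasoning

-- Here the leftover on the left must vanish. It does because n exceeds the length of the tail, so
-- the layer it meets is empty.
sumVal≼layerSum : (ν : Valuation X) → ∀ S {n} → length S ℕ.≤ n → sumVal ν S ≼ layerSum ν S 0 n
sumVal≼layerSum ν []      _ = 0≼ _
sumVal≼layerSum ν (V ∷ S) {n} ∣S∣<n = begin
  val ν V +ᴿ sumVal ν S                                 ≈⟨ +-comm (val ν V) (sumVal ν S) ⟩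
  sumVal ν S +ᴿ val ν V                                 ≤⟨ +-mono (sumVal≼layerSum ν S (ℕ.<⇒≤ ∣S∣<n))
                                                            (val-≼ ν λ _ v → v , tt) ⟩
  layerSum ν S 0 n +ᴿ val ν (V ∩ᵒ ⊤ᵒ)                   ≈⟨ layerSum-∷ ν V S 0 n ⟨
  layerSum ν (V ∷ S) 0 n +ᴿ val ν (V ∩ᵒ atLeast n S)    ≤⟨ +-mono (≼-refl {r = layerSum ν (V ∷ S) 0 n})
                                                            (val-empty ν λ _ (_ , m) → atLeast-empty n S ∣S∣<n m) ⟩
  layerSum ν (V ∷ S) 0 n +ᴿ 0ᴿ                          ≈⟨ +-identityʳ (layerSum ν (V ∷ S) 0 n) ⟩
  layerSum ν (V ∷ S) 0 n                                ∎
  where open ≼-Reasoning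

module _ (ν : Valuation X) {e} (0<e : 0ℚ ℚ.< e) (O : ℚ → Open X) (S : List (Open X)) where

  -- The inclusion is required only for k < N, since finitely many levels cannot detect arbitrarily
  -- large values. `O` is a general family so that it can carry a shifted threshold.
  lowerSum≼layerSum : ∀ N → (∀ k x → k ℕ.< N → mem (O (suc k · e)) x → mem (atLeast (suc k) S) x) →
    ∀ k n → k ℕ.+ n ℕ.≤ N → lowerSum (λ t → val ν (O t)) (k · e) (uniform e 0<e n) ≼ fromℚ e *ᴿ layerSum ν S k n
  lowerSum≼layerSum N O⊆ k zero    _ = 0≼ _
  lowerSum≼layerSum N O⊆ k (suc n) k+n<N rewrite ℕ.+-suc k n | ℚ.+-comm (k · e) e = ≼-trans
    (+-mono (*-mono (≼-refl {r = fromℚ e}) (val-≼ ν λ x → O⊆ k x (ℕ.≤-trans (ℕ.s≤s (ℕ.m≤m+n k n)) k+n<N)))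
            (lowerSum≼layerSum N O⊆ (suc k) n k+n<N))
    (≋⇒≽ (*-distribˡ-+ (fromℚ e) (val ν (atLeast (suc k) S)) (layerSum ν S (suc k) n)))

  layerSum≼lowerSum : (∀ k x → mem (atLeast (suc k) S) x → mem (O (suc k · e)) x) →
    ∀ k n → fromℚ e *ᴿ layerSum ν S k n ≼ lowerSum (λ t → val ν (O t)) (k · e) (uniform e 0<e n)
  layerSum≼lowerSum ⊆O k zero    = ≋⇒≼ (*-zeroʳ (fromℚ e))
  layerSum≼lowerSum ⊆O k (suc n) rewrite ℚ.+-comm (k · e) e = ≼-trans
    (≋⇒≼ (*-distribˡ-+ (fromℚ e) (val ν (atLeast (suc k) S)) (layerSum ν S (suc k) n)))
    (+-mono (*-mono (≼-refl {r = fromℚ e}) (val-≼ ν (⊆O k))) (layerSum≼lowerSum ⊆O (suc k) n))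

levels : X →ℝ₊∞ → ℚ → ℚ → ℕ → List (Open X)
levels h a e zero    = []
levels h a e (suc n) = superlevel h (a ℚ.+ e) ∷ levels h (a ℚ.+ e) e n

lowerSum-levels : (h : X →ℝ₊∞) (ν : Valuation X) → ∀ a {e} (0<e : 0ℚ ℚ.< e) n →
                  lowerSum (tail h ν) a (uniform e 0<e n) ≋ fromℚ e *ᴿ sumVal ν (levels h a e n)
lowerSum-levels h ν a {e} 0<e zero    = ≋-sym (*-zeroʳ (fromℚ e))
lowerSum-levels h ν a {e} 0<e (suc n) = ≋-trans
  (+-cong (≋-refl {r = fromℚ e *ᴿ tail h ν (a ℚ.+ e)}) (lowerSum-levels h ν (a ℚ.+ e) 0<e n))
  (≋-sym (*-distribˡ-+ (fromℚ e) (tail h ν (a ℚ.+ e)) (sumVal ν (levels h (a ℚ.+ e) e n))))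

module _ (h : X →ℝ₊∞) {e} (0<e : 0ℚ ℚ.< e) {x : DCPO.Carrier X} where

  -- The listed superlevel sets decrease, so lying in any `suc k` of them forces h(x) above the
  -- threshold with index `suc k`. A count of 0 would give no bound.
  atLeast-levels⁻ : ∀ a k n → mem (atLeast (suc k) (levels h a e n)) x → a ℚ.+ suc k · e <ᶜ fun h x
  atLeast-levels⁻ a k (suc n) (inj₁ m) = lowered (fun h x)
    (ℚ.+-monoˡ-≤ (suc k · e) (subst (ℚ._≤ a ℚ.+ e) (ℚ.+-identityʳ a) (ℚ.+-monoʳ-≤ a (ℚ.<⇒≤ 0<e))))
    (atLeast-levels⁻ (a ℚ.+ e) k n m)
  atLeast-levels⁻ a zero (suc n) (inj₂ (a+e<h , _)) =
    subst (cut (fun h x)) (cong (a ℚ.+_) (sym (ℚ.+-identityʳ e))) a+e<h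
  atLeast-levels⁻ a (suc k) (suc n) (inj₂ (_ , m)) =
    subst (cut (fun h x)) (ℚ.+-assoc a e (suc k · e)) (atLeast-levels⁻ (a ℚ.+ e) k n m)

  -- The case k = 0 is separate because membership is then vacuous, while a itself need not lie
  -- below h(x).
  atLeast-levels⁺ : ∀ a k n → k ℕ.≤ n → k ≡ 0 ⊎ a ℚ.+ k · e <ᶜ fun h x → mem (atLeast k (levels h a e n)) x
  atLeast-levels⁺ a zero    n       _           _        = tt
  atLeast-levels⁺ a (suc k) (suc n) (ℕ.s≤s k≤n) (inj₂ c) = inj₂
    ( lowered (fun h x) (ℚ.≤-trans (p≤p+n·e (a ℚ.+ e) k 0<e) (ℚ.≤-reflexive (ℚ.+-assoc a e (k · e)))) c
    , atLeast-levels⁺ (a ℚ.+ e) k n k≤n (inj₂ (subst (cut (fun h x)) (sym (ℚ.+-assoc a e (k · e))) c)))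

-- Linearity of the integral

atLeast-levels⇒<+ : (h h′ : X →ℝ₊∞) → ∀ {e} → 0ℚ ℚ.< e → ∀ k n n′ {x} →
  mem (atLeast (suc k) (levels h 0ℚ e n ++ levels h′ 0ℚ e n′)) x → suc k · e <ᶜ fun (h +ᶠ h′) x
atLeast-levels⇒<+ h h′ {e} 0<e k n n′ {x} m with atLeast-++⁻ (suc k) (levels h 0ℚ e n) (levels h′ 0ℚ e n′) m
-- A zero count says nothing about h, not even that h(x) is positive, so the whole threshold has to
-- come from h′.
... | zero , suc j , refl , _ , mⱼ =
  at (s≼r+s (fun h x) (fun h′ x)) (subst (cut (fun h′ x)) (ℚ.+-identityˡ (suc j · e))
    (atLeast-levels⁻ h′ 0<e 0ℚ j n′ mⱼ))
... | suc i , zero , eq , mᵢ , _ =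
  subst (λ k → k · e <ᶜ fun (h +ᶠ h′) x) (sym (trans eq (ℕ.+-identityʳ (suc i))))
    (at (r≼r+s (fun h x) (fun h′ x)) (subst (cut (fun h x)) (ℚ.+-identityˡ (suc i · e))
      (atLeast-levels⁻ h 0<e 0ℚ i n mᵢ)))
... | suc i , suc j , eq , mᵢ , mⱼ =
    0ℚ ℚ.+ suc i · e , 0ℚ ℚ.+ suc j · e , atLeast-levels⁻ h 0<e 0ℚ i n mᵢ , atLeast-levels⁻ h′ 0<e 0ℚ j n′ mⱼ
  , ℚ.≤-reflexive (trans (cong (_· e) eq) (trans (×-homo-+ e (suc i) (suc j))
      (sym (cong₂ ℚ._+_ (ℚ.+-identityˡ (suc i · e)) (ℚ.+-identityˡ (suc j · e))))))

-- Rounds a down to a multiple of e, capped at m. The alternatives with 0 cover negative a, which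
-- occur because every cut contains the negative rationals.
locate : ∀ a e m → (m ≡ 0 ⊎ m · e ℚ.≤ a) ⊎
         ∃ λ i → i ℕ.< m × (i ≡ 0 ⊎ i · e ℚ.≤ a) × a ℚ.< suc i · e
locate a e zero    = inj₁ (inj₁ refl)
locate a e (suc m) with locate a e m
... | inj₂ (i , i<m , i·e≤a , a<) = inj₂ (i , ℕ.m<n⇒m<1+n i<m , i·e≤a , a<)
... | inj₁ m·e≤a with suc m · e ℚ.≤? a
...   | yes le = inj₁ (inj₂ le)
...   | no  gt = inj₂ (m , ℕ.≤-refl , m·e≤a , ℚ.≰⇒> gt)

multiple≤⇒atLeast : (h : X →ℝ₊∞) → ∀ {e} → 0ℚ ℚ.< e → ∀ m {n x a} → m ℕ.≤ n → a <ᶜ fun h x →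
  m ≡ 0 ⊎ m · e ℚ.≤ a → mem (atLeast m (levels h 0ℚ e n)) x
multiple≤⇒atLeast h 0<e m {n} m≤n a<h (inj₁ m≡0) = atLeast-levels⁺ h 0<e 0ℚ m n m≤n (inj₁ m≡0)
multiple≤⇒atLeast h {e} 0<e m {n} {x} m≤n a<h (inj₂ m·e≤a) = atLeast-levels⁺ h 0<e 0ℚ m n m≤n
  (inj₂ (lowered (fun h x) (ℚ.≤-trans (ℚ.≤-reflexive (ℚ.+-identityˡ (m · e))) m·e≤a) a<h))

-- The slack e pays for rounding the two summands down to multiples of e.
<+⇒atLeast-levels : (h h′ : X →ℝ₊∞) → ∀ {e} → 0ℚ ℚ.< e → ∀ k n {x} → k ℕ.< n →
  suc k · e ℚ.+ e <ᶜ fun (h +ᶠ h′) x → mem (atLeast (suc k) (levels h 0ℚ e n ++ levels h′ 0ℚ e n)) x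
<+⇒atLeast-levels {X = X} h h′ {e} 0<e k n {x} k<n (a , b , a<h , b<h′ , ≤a+b) with locate a e (suc k)
... | inj₁ sk·e≤a = subst (λ m → mem (atLeast m (levels h 0ℚ e n ++ levels h′ 0ℚ e n)) x) (ℕ.+-identityʳ (suc k))
    (atLeast-++⁺ (suc k) 0 (levels h 0ℚ e n) (levels h′ 0ℚ e n) (multiple≤⇒atLeast h 0<e (suc k) k<n a<h sk·e≤a) tt)
... | inj₂ (i , ℕ.s≤s i≤k , i·e≤a , a<) with ℕ.m≤n⇒∃[o]m+o≡n i≤k
...   | j , refl = subst (λ m → mem (atLeast m (levels h 0ℚ e n ++ levels h′ 0ℚ e n)) x) (ℕ.+-suc i j)
    (atLeast-++⁺ i (suc j) (levels h 0ℚ e n) (levels h′ 0ℚ e n)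
      (multiple≤⇒atLeast h 0<e i (ℕ.≤-trans i≤k (ℕ.<⇒≤ k<n)) a<h i·e≤a)
      (multiple≤⇒atLeast h′ 0<e (suc j) (ℕ.≤-trans (ℕ.s≤s (ℕ.m≤n+m j i)) k<n) b<h′ (inj₂ (ℚ.<⇒≤ sj·e<b))))
  where
  open +-*-Solver
  sj·e<b : suc j · e ℚ.< b
  sj·e<b = +-cancelˡ-< (suc i · e) (ℚ.≤-<-trans
    (ℚ.≤-reflexive (trans
      (solve 3 (λ e ie je → (e :+ ie) :+ (e :+ je) := (e :+ (ie :+ je)) :+ e) refl e (i · e) (j · e))
      (cong (λ q → e ℚ.+ q ℚ.+ e) (sym (×-homo-+ e i j)))))
    (ℚ.≤-<-trans ≤a+b (ℚ.+-monoˡ-< b a<)))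

∫-+-superadditive : (h h′ : X →ℝ₊∞) (ν : Valuation X) → ∫ h ν +ᴿ ∫ h′ ν ≼ ∫ (h +ᶠ h′) ν
∫-+-superadditive h h′ ν = ⟨ (λ (a , b , (ds , a<) , (ds′ , b<) , p≤) →
  let (e , 0<e , N , refines) = common-refinement (lower ds) (lower ds′)
  in at (uniform-superadditive 0<e N)
       (a , b , at (proj₁ (refines (tail h ν) (tail-antitone h ν))) a<
              , at (proj₂ (refines (tail h′ ν) (tail-antitone h′ ν))) b< , p≤)) ⟩
  where
  uniform-superadditive : ∀ {e} (0<e : 0ℚ ℚ.< e) N →
    lowerSum (tail h ν) 0ℚ (uniform e 0<e N) +ᴿ lowerSum (tail h′ ν) 0ℚ (uniform e 0<e N) ≼ ∫ (h +ᶠ h′) ν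
  uniform-superadditive {e} 0<e N = begin
    lowerSum (tail h ν) 0ℚ (uniform e 0<e N) +ᴿ lowerSum (tail h′ ν) 0ℚ (uniform e 0<e N)
      ≈⟨ +-cong (lowerSum-levels h ν 0ℚ 0<e N) (lowerSum-levels h′ ν 0ℚ 0<e N) ⟩
    fromℚ e *ᴿ sumVal ν S +ᴿ fromℚ e *ᴿ sumVal ν T
      ≈⟨ *-distribˡ-+ (fromℚ e) (sumVal ν S) (sumVal ν T) ⟨
    fromℚ e *ᴿ (sumVal ν S +ᴿ sumVal ν T)
      ≈⟨ *-cong (≋-refl {r = fromℚ e}) (sumVal-++ ν S T) ⟨
    fromℚ e *ᴿ sumVal ν (S ++ T)
      ≤⟨ *-mono (≼-refl {r = fromℚ e}) (sumVal≼layerSum ν (S ++ T) ℕ.≤-refl) ⟩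
    fromℚ e *ᴿ layerSum ν (S ++ T) 0 M
      ≤⟨ layerSum≼lowerSum ν 0<e (superlevel (h +ᶠ h′)) (S ++ T) (λ k x → atLeast-levels⇒<+ h h′ 0<e k N N) 0 M ⟩
    lowerSum (tail (h +ᶠ h′) ν) 0ℚ (uniform e 0<e M)
      ≤⟨ lowerSum≼riemann (tail (h +ᶠ h′) ν) (uniform e 0<e M) ⟩
    ∫ (h +ᶠ h′) ν ∎
    where
    open ≼-Reasoning
    S = levels h 0ℚ e N
    T = levels h′ 0ℚ e N
    -- All layers of the joint list are summed, so h + h′ gets twice as many steps as each summand.
    M = length (S ++ T)

-- { h > t } is the directed union of the sets { h > t + c } over c > 0, so a small shift does not
-- lose the given p. That c divides e allows steps that are multiples of e to be refined to mesh c.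
lowerSum-slack : (h : X →ℝ₊∞) (ν : Valuation X) → ∀ {e} → 0ℚ ℚ.< e → ∀ a ds {p} → p <ᶜ lowerSum (tail h ν) a ds →
  ∃ λ c → 0ℚ ℚ.< c × IsMultipleOf c e × p <ᶜ lowerSum (λ t → tail h ν (t ℚ.+ c)) a ds
lowerSum-slack {ℓ} {X} h ν {e} 0<e a ds p< =
  let (lift (c , 0<c , c∣e) , p<ᶜ) =
        lowerSum-approx h ν O (lift (e , 0<e , 1 , sym (ℚ.+-identityʳ e))) upper below approx a ds p<
  in c , 0<c , c∣e , p<ᶜ
  where
  Slack : Set ℓ
  Slack = Lift ℓ (∃ λ c → 0ℚ ℚ.< c × IsMultipleOf c e)
  O : Slack → ℚ → Open X
  O (lift (c , _)) t = superlevel h (t ℚ.+ c)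
  shrink : ∀ {b c} → b ℚ.≤ c → ∀ t x → t ℚ.+ c <ᶜ fun h x → t ℚ.+ b <ᶜ fun h x
  shrink b≤c t x = lowered (fun h x) (ℚ.+-monoʳ-≤ t b≤c)
  upper : ∀ i j → ∃ λ k → (∀ t x → mem (O i t) x → mem (O k t) x) × (∀ t x → mem (O j t) x → mem (O k t) x)
  upper (lift (c , 0<c , c∣e)) (lift (c′ , 0<c′ , _)) =
    let (b , 0<b , b∣c , b∣c′) = common-unit₂ 0<c 0<c′ in
    lift (b , 0<b , multiple-trans b∣c c∣e) , shrink (unit≤multiple 0<b 0<c b∣c) , shrink (unit≤multiple 0<b 0<c′ b∣c′)
  below : ∀ i t x → mem (O i t) x → t <ᶜ fun h x
  below (lift (c , 0<c , _)) t x = lowered (fun h x)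
    (subst (ℚ._≤ t ℚ.+ c) (ℚ.+-identityʳ t) (ℚ.+-monoʳ-≤ t (ℚ.<⇒≤ 0<c)))
  approx : ∀ t x → t <ᶜ fun h x → ∃ λ i → mem (O i t) x
  approx t x t<h =
    let (q , t<q , q<h) = rounded (fun h x) t<h
        0<q-t = subst (ℚ._< q ℚ.- t) (ℚ.+-inverseʳ t) (ℚ.+-monoˡ-< (ℚ.- t) t<q)
        -- Making c divide q - t as well bounds it by q - t, whence t + c ≤ q.
        (c , 0<c , c∣e , c∣q-t) = common-unit₂ 0<e 0<q-t
    in lift (c , 0<c , c∣e) , lowered (fun h x)
         (ℚ.≤-trans (ℚ.+-monoʳ-≤ t (unit≤multiple 0<c 0<q-t c∣q-t))
           (ℚ.≤-reflexive (solve 2 (λ t q → t :+ (q :- t) := q) refl t q))) q<h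
    where open +-*-Solver

-- The slack c is found first and then serves as the mesh, so the shift by c pays exactly for the
-- one mesh width lost in rounding.
∫-+-subadditive : (h h′ : X →ℝ₊∞) (ν : Valuation X) → ∫ (h +ᶠ h′) ν ≼ ∫ h ν +ᴿ ∫ h′ ν
∫-+-subadditive h h′ ν = riemann-least λ ds → ⟨ below ds ⟩
  where
  uniform-subadditive : ∀ {c} (0<c : 0ℚ ℚ.< c) N →
    lowerSum (λ t → tail (h +ᶠ h′) ν (t ℚ.+ c)) 0ℚ (uniform c 0<c N) ≼ ∫ h ν +ᴿ ∫ h′ ν
  uniform-subadditive {c} 0<c N = begin
    lowerSum (λ t → tail (h +ᶠ h′) ν (t ℚ.+ c)) 0ℚ (uniform c 0<c N)
      ≤⟨ lowerSum≼layerSum ν 0<c (λ t → superlevel (h +ᶠ h′) (t ℚ.+ c)) (S ++ T) N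
           (λ k x → <+⇒atLeast-levels h h′ 0<c k N) 0 N ℕ.≤-refl ⟩
    fromℚ c *ᴿ layerSum ν (S ++ T) 0 N
      ≤⟨ *-mono (≼-refl {r = fromℚ c}) (layerSum≼sumVal ν (S ++ T) N) ⟩
    fromℚ c *ᴿ sumVal ν (S ++ T)
      ≈⟨ *-cong (≋-refl {r = fromℚ c}) (sumVal-++ ν S T) ⟩
    fromℚ c *ᴿ (sumVal ν S +ᴿ sumVal ν T)
      ≈⟨ *-distribˡ-+ (fromℚ c) (sumVal ν S) (sumVal ν T) ⟩
    fromℚ c *ᴿ sumVal ν S +ᴿ fromℚ c *ᴿ sumVal ν T
      ≈⟨ +-cong (lowerSum-levels h ν 0ℚ 0<c N) (lowerSum-levels h′ ν 0ℚ 0<c N) ⟨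
    lowerSum (tail h ν) 0ℚ (uniform c 0<c N) +ᴿ lowerSum (tail h′ ν) 0ℚ (uniform c 0<c N)
      ≤⟨ +-mono (lowerSum≼riemann (tail h ν) (uniform c 0<c N)) (lowerSum≼riemann (tail h′ ν) (uniform c 0<c N)) ⟩
    ∫ h ν +ᴿ ∫ h′ ν ∎
    where
    open ≼-Reasoning
    S = levels h 0ℚ c N
    T = levels h′ 0ℚ c N
  below : ∀ ds {p} → p <ᶜ lowerSum (tail (h +ᶠ h′) ν) 0ℚ ds → p <ᶜ ∫ h ν +ᴿ ∫ h′ ν
  below ds p< =
    let (e , 0<e , e∣ds)       = common-unit ds
        (c , 0<c , c∣e , p<ᶜ)  = lowerSum-slack (h +ᶠ h′) ν 0<e 0ℚ ds p<
        (N , refines)          = lowerSum-refine 0<c (All.map (multiple-trans c∣e) e∣ds)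
    in at (uniform-subadditive 0<c N) (at (refines (λ t → tail (h +ᶠ h′) ν (t ℚ.+ c))
            (λ s≤t → tail-antitone (h +ᶠ h′) ν (ℚ.+-monoˡ-≤ c s≤t)) 0ℚ) p<ᶜ)

∫-+ : (h h′ : X →ℝ₊∞) (ν : Valuation X) → ∫ (h +ᶠ h′) ν ≋ ∫ h ν +ᴿ ∫ h′ ν
∫-+ h h′ ν = ∫-+-subadditive h h′ ν , ∫-+-superadditive h h′ ν

-- Homogeneity of the integral

scaleSteps : ∀ {a} → 0ℚ ℚ.< a → Steps → Steps
scaleSteps 0<a []                 = []
scaleSteps {a} 0<a ((d , d-pos) ∷ ds) =
  (a ℚ.* d , ℚ.positive (*-pos 0<a (ℚ.positive⁻¹ d {{d-pos}}))) ∷ scaleSteps 0<a ds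

lowerSum-scale : ∀ {a} (0<a : 0ℚ ℚ.< a) (g : ℚ → ℝ₊∞ ℓ) → ∀ s ds →
  fromℚ a *ᴿ lowerSum (λ t → g (a ℚ.* t)) s ds ≋ lowerSum g (a ℚ.* s) (scaleSteps 0<a ds)
lowerSum-scale {a = a} 0<a g s [] = *-zeroʳ (fromℚ a)
lowerSum-scale {a = a} 0<a g s ((d , d-pos) ∷ ds) rewrite sym (ℚ.*-distribˡ-+ a s d) = begin-equality
  fromℚ a *ᴿ (fromℚ d *ᴿ G +ᴿ L)
    ≈⟨ *-distribˡ-+ (fromℚ a) (fromℚ d *ᴿ G) L ⟩
  fromℚ a *ᴿ (fromℚ d *ᴿ G) +ᴿ fromℚ a *ᴿ L
    ≈⟨ +-cong (≋-sym (*-assoc (fromℚ a) (fromℚ d) G)) (lowerSum-scale 0<a g (s ℚ.+ d) ds) ⟩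
  fromℚ a *ᴿ fromℚ d *ᴿ G +ᴿ R
    ≈⟨ +-cong (*-cong (fromℚ-* 0<a (ℚ.positive⁻¹ d {{d-pos}})) (≋-refl {r = G})) (≋-refl {r = R}) ⟨
  fromℚ (a ℚ.* d) *ᴿ G +ᴿ R ∎
  where
  open ≼-Reasoning
  G = g (a ℚ.* (s ℚ.+ d))
  L = lowerSum (λ t → g (a ℚ.* t)) (s ℚ.+ d) ds
  R = lowerSum g (a ℚ.* (s ℚ.+ d)) (scaleSteps 0<a ds)

lowerSum-scale-0 : ∀ {a} (0<a : 0ℚ ℚ.< a) (g : ℚ → ℝ₊∞ ℓ) → ∀ ds →
  fromℚ a *ᴿ lowerSum (λ t → g (a ℚ.* t)) 0ℚ ds ≼ riemann g
lowerSum-scale-0 {a = a} 0<a g ds = begin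
  fromℚ a *ᴿ lowerSum (λ t → g (a ℚ.* t)) 0ℚ ds  ≈⟨ lowerSum-scale 0<a g 0ℚ ds ⟩
  lowerSum g (a ℚ.* 0ℚ) (scaleSteps 0<a ds)      ≡⟨ cong (λ s → lowerSum g s (scaleSteps 0<a ds)) (ℚ.*-zeroʳ a) ⟩
  lowerSum g 0ℚ (scaleSteps 0<a ds)              ≤⟨ lowerSum≼riemann g (scaleSteps 0<a ds) ⟩
  riemann g                                      ∎
  where open ≼-Reasoning

*-least : {r s t : ℝ₊∞ ℓ} → (∀ {a} → 0ℚ ℚ.< a → a <ᶜ r → fromℚ a *ᴿ s ≼ t) → r *ᴿ s ≼ t
*-least {r = r} {t = t} below = ⟨ (λ
  { (inj₁ (lift p<0)) → negative t p<0
  ; (inj₂ (a , b , 0≤a , 0≤b , a<r , b<s , p<ab)) →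
      let (a′ , a<a′ , a′<r) = rounded r a<r
      in at (below (ℚ.≤-<-trans 0≤a a<a′) a′<r) (inj₂ (a , b , 0≤a , 0≤b , fromℚ-< a<a′ , b<s , p<ab)) }) ⟩

-- For 0 < a < r the set { h > t } lies in { r h > a t }, and substituting a t for t in the integral
-- absorbs the factor a.
*-∫-≼ : (r : ℝ₊∞ ℓ) {X : DCPO ℓ} (h : X →ℝ₊∞) (ν : Valuation X) → r *ᴿ ∫ h ν ≼ ∫ (r *ᶠ h) ν
*-∫-≼ r h ν = *-least λ {a} 0<a a<r → *-riemann-least λ ds → begin
  fromℚ a *ᴿ lowerSum (tail h ν) 0ℚ ds
    ≤⟨ *-mono (≼-refl {r = fromℚ a}) (lowerSum-≼ (λ t → val-≼ ν λ x → *-intro-pos r (fun h x) 0<a a<r) 0ℚ ds) ⟩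
  fromℚ a *ᴿ lowerSum (λ t → tail (r *ᶠ h) ν (a ℚ.* t)) 0ℚ ds
    ≤⟨ lowerSum-scale-0 0<a (tail (r *ᶠ h) ν) ds ⟩
  ∫ (r *ᶠ h) ν ∎
  where open ≼-Reasoning

∫-fromℚ-* : ∀ {a} → 0ℚ ℚ.≤ a → (h : X →ℝ₊∞) (ν : Valuation X) → ∫ (fromℚ a *ᶠ h) ν ≼ fromℚ a *ᴿ ∫ h ν
∫-fromℚ-* {a = a} 0≤a h ν with 0ℚ ℚ.<? a
... | no a≤0 = ≼-trans (∫-zero (fromℚ a *ᶠ h) ν vanishes) (0≼ (fromℚ a *ᴿ ∫ h ν))
  where
  vanishes : ∀ x → fromℚ a *ᴿ fun h x ≼ 0ᴿ
  vanishes x = ≼-trans (*-mono (fromℚ-mono (ℚ.≮⇒≥ a≤0)) (≼-refl {r = fun h x}))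
    (≋⇒≼ (≋-trans (*-comm 0ᴿ (fun h x)) (*-zeroʳ (fun h x))))
... | yes 0<a = riemann-least λ ds → begin
  lowerSum (tail (fromℚ a *ᶠ h) ν) 0ℚ ds
    ≤⟨ lowerSum-≼ (λ t → val-≼ ν λ x → fromℚ-*-elim (fun h x) 0<c ca≡1) 0ℚ ds ⟩
  L ds
    -- The factor 1 = a c is inserted: c is absorbed by the substitution of c t for t, and a
    -- remains.
    ≈⟨ *-identityˡ (L ds) ⟨
  1ᴿ *ᴿ L ds
    ≡⟨ cong (λ q → fromℚ q *ᴿ L ds) (trans (sym ca≡1) (ℚ.*-comm c a)) ⟩
  fromℚ (a ℚ.* c) *ᴿ L ds
    ≈⟨ *-cong (fromℚ-* 0<a 0<c) (≋-refl {r = L ds}) ⟩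
  fromℚ a *ᴿ fromℚ c *ᴿ L ds
    ≈⟨ *-assoc (fromℚ a) (fromℚ c) (L ds) ⟩
  fromℚ a *ᴿ (fromℚ c *ᴿ L ds)
    ≤⟨ *-mono (≼-refl {r = fromℚ a}) (lowerSum-scale-0 0<c (tail h ν) ds) ⟩
  fromℚ a *ᴿ ∫ h ν ∎
  where
  open ≼-Reasoning
  c = proj₁ (reciprocal 0<a)
  0<c = proj₁ (proj₂ (reciprocal 0<a))
  ca≡1 = proj₂ (proj₂ (reciprocal 0<a))
  L : Steps → ℝ₊∞ _
  L = lowerSum (λ t → tail h ν (c ℚ.* t)) 0ℚ

-- A general r has no rational inverse to substitute with, so r h is approximated by the directed
-- family of a h with a rational.
∫-*-≼ : (r : ℝ₊∞ ℓ) {X : DCPO ℓ} (h : X →ℝ₊∞) (ν : Valuation X) → ∫ (r *ᶠ h) ν ≼ r *ᴿ ∫ h ν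
∫-*-≼ {ℓ} r {X} h ν = riemann-least λ ds → ⟨ (λ p< →
  let ((a , 0≤a , a≼r) , p<ᵃ) = lowerSum-approx (r *ᶠ h) ν O (0ℚ , ℚ.≤-refl , 0≼ r) upper below approx 0ℚ ds p<
  in at (begin
       lowerSum (tail (fromℚ a *ᶠ h) ν) 0ℚ ds  ≤⟨ lowerSum≼riemann (tail (fromℚ a *ᶠ h) ν) ds ⟩
       ∫ (fromℚ a *ᶠ h) ν                      ≤⟨ ∫-fromℚ-* 0≤a h ν ⟩
       fromℚ a *ᴿ ∫ h ν                        ≤⟨ *-mono a≼r (≼-refl {r = ∫ h ν}) ⟩
       r *ᴿ ∫ h ν                              ∎) p<ᵃ) ⟩
  where
  open ≼-Reasoning
  -- The condition is `fromℚ a ≼ r` and not `a <ᶜ r`: for r = 0 the latter would leave no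
  -- nonnegative a, and a directed family needs an index.
  Below : Set ℓ
  Below = ∃ λ a → 0ℚ ℚ.≤ a × fromℚ a ≼ r
  O : Below → ℚ → Open X
  O (a , _) = superlevel (fromℚ a *ᶠ h)
  grow : ∀ {a b} → a ℚ.≤ b → ∀ t x → t <ᶜ fromℚ a *ᴿ fun h x → t <ᶜ fromℚ b *ᴿ fun h x
  grow a≤b t x = at (*-mono (fromℚ-mono a≤b) (≼-refl {r = fun h x}))
  upper : ∀ i j → ∃ λ k → (∀ t x → mem (O i t) x → mem (O k t) x) × (∀ t x → mem (O j t) x → mem (O k t) x)
  upper i@(a , _) j@(b , _) with ℚ.≤-total a b
  ... | inj₁ a≤b = j , grow a≤b , λ t x c → c
  ... | inj₂ b≤a = i , (λ t x c → c) , grow b≤a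
  below : ∀ i t x → mem (O i t) x → t <ᶜ r *ᴿ fun h x
  below (a , _ , a≼r) t x = at (*-mono a≼r (≼-refl {r = fun h x}))
  approx : ∀ t x → t <ᶜ r *ᴿ fun h x → ∃ λ i → mem (O i t) x
  approx t x (inj₁ t<0) = (0ℚ , ℚ.≤-refl , 0≼ r) , inj₁ t<0
  approx t x (inj₂ (a , b , 0≤a , 0≤b , a<r , b<h , t<ab)) =
    let (a′ , a<a′ , a′<r) = rounded r a<r
    in (a′ , ℚ.≤-trans 0≤a (ℚ.<⇒≤ a<a′) , fromℚ-≼ r a′<r) , inj₂ (a , b , 0≤a , 0≤b , fromℚ-< a<a′ , b<h , t<ab)

∫-* : (r : ℝ₊∞ ℓ) {X : DCPO ℓ} (h : X →ℝ₊∞) (ν : Valuation X) → ∫ (r *ᶠ h) ν ≋ r *ᴿ ∫ h ν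
∫-* r h ν = ∫-*-≼ r h ν , *-∫-≼ r h ν

-- Linear combinations and simple valuations

combination : ∀ n → (Fin n → ℝ₊∞ ℓ) → {X : DCPO ℓ} → (Fin n → X →ℝ₊∞) → X →ℝ₊∞
combination zero    r h = 0ᶠ
combination (suc n) r h = r zero *ᶠ h zero +ᶠ combination n (r ∘ suc) (h ∘ suc)

fun-combination : ∀ n (r : Fin n → ℝ₊∞ ℓ) {X : DCPO ℓ} (h : Fin n → X →ℝ₊∞) x →
  fun (combination n r h) x ≋ sumᴿ n (λ i → r i *ᴿ fun (h i) x)
fun-combination zero    r h x = ≋-refl
fun-combination (suc n) r h x =
  +-cong (≋-refl {r = r zero *ᴿ fun (h zero) x}) (fun-combination n (r ∘ suc) (h ∘ suc) x)

∫-combination : ∀ n (r : Fin n → ℝ₊∞ ℓ) {X : DCPO ℓ} (h : Fin n → X →ℝ₊∞) (ν : Valuation X) →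
  ∫ (combination n r h) ν ≋ sumᴿ n (λ i → r i *ᴿ ∫ (h i) ν)
∫-combination zero    r h ν = ∫-zero 0ᶠ ν (λ _ → ≼-refl) , 0≼ (∫ 0ᶠ ν)
∫-combination (suc n) r h ν = ≋-trans
  (∫-+ (r zero *ᶠ h zero) (combination n (r ∘ suc) (h ∘ suc)) ν)
  (+-cong (∫-* (r zero) (h zero) ν) (∫-combination n (r ∘ suc) (h ∘ suc) ν))

∫-simple : ∀ n (r : Fin n → ℝ₊∞ ℓ) {X : DCPO ℓ} (x : Fin n → DCPO.Carrier X) (μ : Valuation X) →
  (∀ U → val μ U ≈ᴿ sumᴿ n (λ i → r i *ᴿ δ (x i) U)) →
  ∀ h → ∫ h μ ≋ sumᴿ n (λ i → r i *ᴿ fun h (x i))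
∫-simple n r x μ μ≈ h = begin-equality
  riemann (tail h μ)
    ≈⟨ riemann-≋ (λ t → ≈⇒≋ {r = tail h μ t} {sumᴿ n (λ i → G i t)} (μ≈ (superlevel h t))) ⟩
  riemann (λ t → sumᴿ n (λ i → G i t))
    ≈⟨ riemann-sumᴿ n (λ i s≤t → *-mono (≼-refl {r = r i}) (indicator-mono (lowered (fun h (x i)) s≤t))) ⟩
  sumᴿ n (λ i → riemann (G i))
    ≈⟨ sumᴿ-cong n (λ i → ≋-trans (riemann-* (r i) (λ t → indicator (t <ᶜ fun h (x i))))
                                  (*-cong (≋-refl {r = r i}) (riemann-indicator (fun h (x i))))) ⟩
  sumᴿ n (λ i → r i *ᴿ fun h (x i)) ∎
  where
  open ≼-Reasoning
  G : Fin n → ℚ → ℝ₊∞ _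
  G i t = r i *ᴿ indicator (t <ᶜ fun h (x i))

-- Directed suprema of valuations

module _ {ℓ} {X : DCPO ℓ} {I : Set ℓ} (s : I → Valuation X) (d : IsDirected (Valuation-poset X) s) where
  open IsDirected d

  -- A supremum in the poset of valuations is least among valuations only. To see that it is
  -- computed pointwise, the pointwise supremum must itself be a valuation to compare with.
  ⨆ᵛ : Valuation X
  ⨆ᵛ = record
    { val = λ U → ⋃ᴿ inhabitant (λ i → val (s i) U)
    ; continuous = record
      { mono = λ U⊆V p (i , p<) → i , at (val-≼ (s i) U⊆V) p<
      ; sup = λ U dU l → record
        { bound = λ j p (i , p<) → i , at (val-≼ (s i) (IsSup.bound l j)) p<
        ; least = λ r b p (i , p<) →
            let (j , p<ⱼ) = <ᶜ-sup
                  record { inhabitant = IsDirected.inhabitant dU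
                         ; upper = λ j j′ → let (k , j⊆k , j′⊆k) = IsDirected.upper dU j j′ in
                             k , (λ _ → at (val-≼ (s i) j⊆k)) , (λ _ → at (val-≼ (s i) j′⊆k)) }
                  (IsScottContinuous.sup (continuous (s i)) U dU l) p<
            in b j p (i , p<ⱼ)
        }
      }
    ; strict = (λ p (i , p<) → proj₁ (strict (s i)) p p<) , λ p p<0 → inhabitant , proj₂ (strict (s inhabitant)) p p<0
    ; modular = λ U V → sum-≤ {U ∪ᵒ V} {U ∩ᵒ V} {U} {V} (λ k → proj₁ (modular (s k) U V))
                      , sum-≤ {U} {V} {U ∪ᵒ V} {U ∩ᵒ V} (λ k → proj₂ (modular (s k) U V))
    }
    where
    sum-≤ : ∀ {A B C D : Open X} →
      (∀ k → val (s k) A +ᴿ val (s k) B ≤ᴿ val (s k) C +ᴿ val (s k) D) →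
      ⋃ᴿ inhabitant (λ i → val (s i) A) +ᴿ ⋃ᴿ inhabitant (λ i → val (s i) B) ≤ᴿ
      ⋃ᴿ inhabitant (λ i → val (s i) C) +ᴿ ⋃ᴿ inhabitant (λ i → val (s i) D)
    sum-≤ {A} {B} sums p (a , b , (i , a<) , (j , b<) , p≤) =
      -- The two summands may be attained at different indices; directedness moves both to one k,
      -- where modularity holds.
      let (k , i≤k , j≤k) = upper i j
          (a′ , b′ , a′< , b′< , p≤′) = sums k p (a , b , i≤k A a a< , j≤k B b b< , p≤)
      in a′ , b′ , (k , a′<) , (k , b′<) , p≤′

  val-approx : ∀ {μ} → IsSup (Valuation-poset X) s μ → ∀ U {p} → p <ᶜ val μ U → ∃ λ i → p <ᶜ val (s i) U
  val-approx l U {p} = IsSup.least l ⨆ᵛ (λ i V q q< → i , q<) U p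

  ∫-approx : ∀ {μ} → IsSup (Valuation-poset X) s μ → ∀ h {p} → p <ᶜ ∫ h μ → ∃ λ i → p <ᶜ ∫ h (s i)
  ∫-approx {μ} l h (ds , p<) =
    let (i , p<ᵢ) = lowerSum-sup (tail h μ) (λ i → tail h (s i)) inhabitant
          (λ i j → let (k , i≤k , j≤k) = upper i j in
            k , (λ t → i≤k (superlevel h t)) , (λ t → j≤k (superlevel h t)))
          (λ t → val-approx l (superlevel h t)) 0ℚ (lower ds) p<
    in i , ds , p<ᵢ

-- Exchange of the two integrals

module _ {ℓ} (X Y : DCPO ℓ) (f : (X ×ᵈ Y) →ℝ₊∞) (ν : Valuation Y) where

  Fubini : Valuation X → Set ℓ
  Fubini μ = ∫ (∫ʸ X Y f ν) μ ≋ ∫ (∫ˣ X Y f μ) ν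

  -- Both sides equal Σᵢ rᵢ ∫ f(xᵢ, y) dν. On the right the inner integral is a linear combination
  -- of sections of f, so linearity in the integrand applies.
  fubini-simple : ∀ {μ} → IsSimple X μ → Fubini μ
  fubini-simple {μ} (n , r , x , _ , μ≈) = begin-equality
    ∫ (∫ʸ X Y f ν) μ
      ≈⟨ ∫-simple n r x μ μ≈ (∫ʸ X Y f ν) ⟩
    sumᴿ n (λ i → r i *ᴿ ∫ (section X Y f (x i)) ν)
      ≈⟨ ∫-combination n r (λ i → section X Y f (x i)) ν ⟨
    ∫ (combination n r (λ i → section X Y f (x i))) ν
      ≈⟨ ∫-≋ (combination n r (λ i → section X Y f (x i))) (∫ˣ X Y f μ) ν
           (λ y → ≋-trans (fun-combination n r (λ i → section X Y f (x i)) y)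
                          (≋-sym (∫-simple n r x μ μ≈ (section Y X (transpose X Y f) y)))) ⟩
    ∫ (∫ˣ X Y f μ) ν ∎
    where open ≼-Reasoning

  ∫ˣ-mono : ∀ {μ μ′} → (∀ U → val μ U ≤ᴿ val μ′ U) → ∀ y → fun (∫ˣ X Y f μ) y ≼ fun (∫ˣ X Y f μ′) y
  ∫ˣ-mono {μ} {μ′} μ≤μ′ y = ∫-val-≼ (section Y X (transpose X Y f) y) {μ} {μ′} (λ U → ⟨ μ≤μ′ U _ ⟩)

  -- On the left μ occurs in the outer integral, so `∫-approx` applies directly. On the right it
  -- sits inside: the superlevel sets of the inner integrals form a directed union, and
  -- Scott-continuity of ν takes over.
  fubini-sup : ∀ {μ} {I : Set ℓ} (s : I → Valuation X) → IsDirected (Valuation-poset X) s →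
               IsSup (Valuation-poset X) s μ → (∀ i → Fubini (s i)) → Fubini μ
  fubini-sup {μ} s d l fubini = ⟨ to ⟩ , ⟨ from ⟩
    where
    open IsDirected d
    to : ∀ {p} → p <ᶜ ∫ (∫ʸ X Y f ν) μ → p <ᶜ ∫ (∫ˣ X Y f μ) ν
    to p< =
      let (i , p<ᵢ) = ∫-approx s d l (∫ʸ X Y f ν) p<
      in at (∫-≼ (∫ˣ X Y f (s i)) (∫ˣ X Y f μ) ν (∫ˣ-mono {s i} {μ} (IsSup.bound l i))) (at (≋⇒≼ (fubini i)) p<ᵢ)
    from : ∀ {p} → p <ᶜ ∫ (∫ˣ X Y f μ) ν → p <ᶜ ∫ (∫ʸ X Y f ν) μ
    from (ds , p<) =
      let (i , p<ᵢ) = lowerSum-approx (∫ˣ X Y f μ) ν (λ i → superlevel (∫ˣ X Y f (s i))) inhabitant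
            (λ i j → let (k , i≤k , j≤k) = upper i j in
              k , (λ t y → at (∫ˣ-mono {s i} {s k} i≤k y)) , (λ t y → at (∫ˣ-mono {s j} {s k} j≤k y)))
            (λ i t y → at (∫ˣ-mono {s i} {μ} (IsSup.bound l i) y))
            (λ t y → ∫-approx s d l (section Y X (transpose X Y f) y))
            0ℚ (lower ds) p<
      in at (∫-val-≼ (∫ʸ X Y f ν) {s i} {μ} (λ U → ⟨ IsSup.bound l i U _ ⟩)) (at (≋⇒≽ (fubini i)) (ds , p<ᵢ))

  fubini-minimal : ∀ {μ} → IsMinimal X μ → Fubini μ
  fubini-minimal {μ} (simple μ-simple)    = fubini-simple {μ} μ-simple
  fubini-minimal {μ} (dsup s d l minimal) = fubini-sup {μ} s d l (λ i → fubini-minimal {s i} (minimal i))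

theorem5p9 : ∀ {ℓ : Level} (X Y : DCPO ℓ) (f : (X ×ᵈ Y) →ℝ₊∞) (μ : Valuation X) (ν : Valuation Y) →
    IsMinimal X μ ⊎ IsMinimal Y ν →
    ∫ (∫ʸ X Y f ν) μ ≈ᴿ ∫ (∫ˣ X Y f μ) ν
theorem5p9 X Y f μ ν (inj₁ μ-minimal) = ≋⇒≈ (fubini-minimal X Y f ν {μ} μ-minimal)
-- The roles of X and Y are exchanged. Transposing twice gives back the values of f, so the inner
-- integrals are matched pointwise.
theorem5p9 X Y f μ ν (inj₂ ν-minimal) = ≋⇒≈ (≋-sym (≋-trans
  (fubini-minimal Y X fᵗ μ {ν} ν-minimal)
  (∫-≋ (∫ˣ Y X fᵗ ν) (∫ʸ X Y f ν) μ λ x →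
    ∫-≋ (section X Y (transpose Y X fᵗ) x) (section X Y f x) ν λ y → ≋-refl)))
  where fᵗ = transpose X Y f
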